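{- Let $\mathcal H=(V,E)$ be a connected hypergraph with a fixed ribbon structure, base node and base edge on $\mathrm{Bip}\,\mathcal H$. The set of final current graphs of the (ht:$E$, cut:$V$) Bernardi process, as $\mathbf f$ ranges over all hypertrees on $E$, equals the set of $V$-cut Jaeger trees; the same holds for the (ht:$V$, cut:$V$) Bernardi process as $\mathbf f$ ranges over all hypertrees on $V$. Likewise, the outcomes of the (ht:$E$, cut:$E$) Bernardi process (over all hypertrees on $E$), as well as the outcomes of the (ht:$V$, cut:$E$) Bernardi process (over all hypertrees on $V$), are exactly the $E$-cut Jaeger trees.
   Context: $\mathcal H=(V,E)$: $V$ finite set, $E$ finite multiset of nonempty subsets of $V$; $\mathrm{Bip}\,\mathcal H$ has color classes $V$ (violet) and $E$ (emerald), $v$ joined to $e$ iff $v\in e$; connected means $\mathrm{Bip}\,\mathcal H$ connected. A ribbon structure assigns to each node $x$ a cyclic permutation of its incident edges; $xy^+$ is the edge following $xy$ at $x$; subgraphs inherit restricted orders ($xy^+_G$ in subgraph $G$). Base node $b_0$, incident base edge $b_0b_1$. A hypertree on $E$ is $\mathbf f:E\to\mathbb Z_{\ge0}$ such that some spanning tree $T$ has $d_T(e)=\mathbf f(e)+1$ for all $e\in E$; symmetrically on $V$. Bernardi processes, $X\in\{E,V\}$, $\mathbf f$ a hypertree on $X$, current graph $G$ initially $\mathrm{Bip}\,\mathcal H$; the outcome is the final current graph. (ht:$X$, cut:$V$): if $b_0\in V$ start with current edge $b_0b_1$; if $b_0\in E$ start with $b_1b_0^+$, $b_0b_1$ counting as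 traversed from $b_0$. With current edge $ve$ ($v\in V$): if $\mathbf f$ is a hypertree on $X$ in $G-ve$, remove $ve$ and make $ve^+_G$ current; otherwise traverse $ve$ from $v$ and $ew:=ev^+_G$ from $e$, and make $we^+_G$ current. (ht:$X$, cut:$E$): if $b_0\in E$ start with $b_0b_1$; if $b_0\in V$ start with $b_1b_0^+$, $b_0b_1$ counting as traversed from $b_0$. With current edge $ev$ ($e\in E$): if $\mathbf f$ is a hypertree on $X$ in $G-ev$, remove $ev$ and make $ev^+_G$ current; otherwise traverse $ev$ from $e$ and $vd:=ve^+_G$ from $v$, and make $dv^+_G$ current. Each process stops right before an edge would be traversed a second time from the same endpoint. Tour of a spanning tree $T$: pairs (current node, current edge) starting with $(b_0,b_0b_1)$; from $(x,xy)$ go to $(x,xy^+)$ if $xy\notin T$, to $(y,yx^+)$ if $xy\in T$; stop right before $(b_0,b_0b_1)$ recurs. Each edge $xy$ appears exactly twice, as $(x,xy)$ and $(y,xy)$; a non-edge $xy$ is cut at $x$ if $(x,xy)$ comes first. $T$ is a $V$-cut (resp. $E$-cut) Jaeger tree if every non-edge of $T$ is cut at its violet (resp. emerald) endpoint. -}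

module Defs where

open import Data.Nat using (ℕ; zero; suc; _≤_; _<_)
open import Data.Fin using (Fin; _≟_)
open import Data.Bool using (Bool; true; false; if_then_else_; _∧_)
open import Data.List using (List; []; _∷_; _++_; reverse; [_])
open import Data.List.Relation.Unary.Unique.Propositional using (Unique)
open import Data.List.Membership.Propositional using (_∈_; _∉_)
open import Data.Maybe using (Maybe; just; nothing; fromMaybe)
open import Data.Product using (Σ; ∃; _×_; _,_; proj₁; proj₂)
open import Data.Sum using (_⊎_; inj₁; inj₂)
open import Data.Empty using (⊥)
open import Relation.Nullary using (¬_; yes; no; does)
open import Relation.Binary.PropositionalEquality using (_≡_; _≢_)
open import Function using (_∘_)
open import Function.Bundles using (_⇔_)

-- rotAfter y L : if L = pre ++ y ∷ post (first occurrence of y),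
-- returns post ++ pre ++ [ y ]  (the cyclic order of L read starting
-- right after y, ending with y); if y ∉ L, returns L.
rotAfter : ∀ {n} → Fin n → List (Fin n) → List (Fin n)
rotAfter {n} y L = go [] L
  where
  go : List (Fin n) → List (Fin n) → List (Fin n)
  go pre [] = L
  go pre (z ∷ zs) with does (z ≟ y)
  ... | true  = zs ++ reverse pre ++ [ y ]
  ... | false = go (z ∷ pre) zs

firstSat : ∀ {A : Set} → (A → Bool) → List A → Maybe A
firstSat P [] = nothing
firstSat P (x ∷ xs) = if P x then just x else firstSat P xs

succIn : ∀ {n} → (Fin n → Bool) → List (Fin n) → Fin n → Fin n
succIn P L y = fromMaybe y (firstSat P (rotAfter y L))

countF : (n : ℕ) → (Fin n → Bool) → ℕ
countF zero    P = zero
countF (suc n) P = (if P Fin.zero then 1 else 0) Data.Nat.+ countF n (P ∘ Fin.suc)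
  where import Data.Fin as Fin
        import Data.Nat

-- Hypergraphs with a ribbon structure on Bip H, base node and base edge.
-- V = Fin nV (violet), E = Fin nE (emerald; a multiset of hyperedges,
-- indexed, so repetitions are allowed), inc v e ≡ true iff v ∈ e,
-- i.e. iff v and e are joined in Bip H.

data Side : Set where
  atV atE : Side          -- which endpoint of the edge ve is the "current node"

flipSide : Side → Side
flipSide atV = atE
flipSide atE = atV

record RibbonHG : Set where
  field
    nV nE   : ℕ
    inc     : Fin nV → Fin nE → Bool
    nonempty : ∀ e → ∃ λ v → inc v e ≡ true
    -- ribbon structure: the cyclic order at each node, given by a list
    -- (read cyclically) enumerating exactly the incident edges, each once
    rotV : Fin nV → List (Fin nE)
    rotE : Fin nE → List (Fin nV)
    rotV-unique : ∀ v → Unique (rotV v)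
    rotE-unique : ∀ e → Unique (rotE e)
    rotV-inc : ∀ v e → (e ∈ rotV v) ⇔ (inc v e ≡ true)
    rotE-inc : ∀ e v → (v ∈ rotE e) ⇔ (inc v e ≡ true)
    -- base node and base edge, encoded as a half-edge (v , e , s):
    -- the base edge is ve, the base node is v if s = atV, e if s = atE
    baseV : Fin nV
    baseE : Fin nE
    baseS : Side
    base-inc : inc baseV baseE ≡ true

module _ (H : RibbonHG) where
  open RibbonHG H

  Node : Set
  Node = Fin nV ⊎ Fin nE

  -- spanning subgraphs of Bip H (given by their edge sets; all nodes kept)
  Sub : Set
  Sub = Fin nV → Fin nE → Bool

  Bip : Sub
  Bip = inc

  _⊆ₛ_ : Sub → Sub → Set
  G ⊆ₛ G' = ∀ v e → G v e ≡ true → G' v e ≡ true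

  _≐_ : Sub → Sub → Set
  G ≐ G' = ∀ v e → G v e ≡ G' v e

  removeEdge : Sub → Fin nV → Fin nE → Sub
  removeEdge G v e v' e' = if does (v' ≟ v) ∧ does (e' ≟ e) then false else G v' e'

  data Adj (G : Sub) : Node → Node → Set where
    ve : ∀ {v e} → G v e ≡ true → Adj G (inj₁ v) (inj₂ e)
    ev : ∀ {v e} → G v e ≡ true → Adj G (inj₂ e) (inj₁ v)

  data Reach (G : Sub) : Node → Node → Set where
    here : ∀ {x} → Reach G x x
    step : ∀ {x y z} → Adj G x y → Reach G y z → Reach G x z

  Connected : Sub → Set
  Connected G = ∀ x y → Reach G x y

  IsTree : Sub → Set
  IsTree T = Connected T × (∀ v e → T v e ≡ true → ¬ Connected (removeEdge T v e))

  SpanningTreeOf : Sub → Sub → Set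
  SpanningTreeOf G T = (T ⊆ₛ G) × IsTree T

  degE : Sub → Fin nE → ℕ
  degE T e = countF nV (λ v → T v e)

  degV : Sub → Fin nV → ℕ
  degV T v = countF nE (λ e → T v e)

  HypertreeE : Sub → (Fin nE → ℕ) → Set
  HypertreeE G f = Σ Sub λ T → SpanningTreeOf G T × (∀ e → degE T e ≡ suc (f e))

  HypertreeV : Sub → (Fin nV → ℕ) → Set
  HypertreeV G f = Σ Sub λ T → SpanningTreeOf G T × (∀ v → degV T v ≡ suc (f v))

  -- half-edges: (v , e , s) is the edge ve seen from v (s = atV) or
  -- from e (s = atE)

  HE : Set
  HE = Fin nV × Fin nE × Side

  flipHE : HE → HE
  flipHE (v , e , s) = (v , e , flipSide s)

  succG : Sub → HE → HE
  succG G (v , e , atV) = (v , succIn (G v) (rotV v) e , atV)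
  succG G (v , e , atE) = (succIn (λ w → G w e) (rotE e) v , e , atE)

  baseHE : HE
  baseHE = (baseV , baseE , baseS)

  tourStep : Sub → HE → HE
  tourStep T (v , e , s) =
    if T v e then succG Bip (flipHE (v , e , s)) else succG Bip (v , e , s)

  iter : ∀ {A : Set} → (A → A) → ℕ → A → A
  iter g zero    a = a
  iter g (suc k) a = g (iter g k a)

  tour : Sub → ℕ → HE
  tour T i = iter (tourStep T) i baseHE

  ComesFirst : Sub → HE → Set
  ComesFirst T h = Σ ℕ λ i → (tour T i ≡ h)
                 × (∀ k → 0 < k → k ≤ i → tour T k ≢ baseHE)
                 × (∀ j → j ≤ i → tour T j ≢ flipHE h)

  -- T is a c-cut Jaeger tree: every non-edge ve of T is cut at its
  -- endpoint of colour c (violet for c = atV, emerald for c = atE)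
  JaegerTree : Side → Sub → Set
  JaegerTree c T = SpanningTreeOf Bip T
                 × (∀ v e → Bip v e ≡ true → T v e ≡ false → ComesFirst T (v , e , c))

  -- Bernardi processes.  HT G expresses "f is a hypertree (on X) in G";
  -- the current half-edge always sits at its endpoint of the cut colour.
  -- Run HT G h trav R : starting from current graph G, current edge h and
  -- set trav of (edge, endpoint) pairs already traversed, the process
  -- ends with final current graph R.

  removeHE : Sub → HE → Sub
  removeHE G (v , e , s) = removeEdge G v e

  data Run (HT : Sub → Set) : Sub → HE → List HE → Sub → Set where
    remove : ∀ {G h trav R} → HT (removeHE G h) →
             Run HT (removeHE G h) (succG G h) trav R →
             Run HT G h trav R
    stop₁  : ∀ {G h trav} → ¬ HT (removeHE G h) → h ∈ trav →
             Run HT G h trav G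
    stop₂  : ∀ {G h trav} → ¬ HT (removeHE G h) → h ∉ trav →
             succG G (flipHE h) ∈ (h ∷ trav) →
             Run HT G h trav G
    next   : ∀ {G h trav R} → ¬ HT (removeHE G h) → h ∉ trav →
             succG G (flipHE h) ∉ (h ∷ trav) →
             Run HT G (succG G (flipHE (succG G (flipHE h))))
                      (succG G (flipHE h) ∷ h ∷ trav) R →
             Run HT G h trav R

  startHE : Side → HE
  startHE atV with baseS
  ... | atV = baseHE
  ... | atE = succG Bip (flipHE baseHE)
  startHE atE with baseS
  ... | atE = baseHE
  ... | atV = succG Bip (flipHE baseHE)

  startTrav : Side → List HE
  startTrav atV with baseS
  ... | atV = []
  ... | atE = baseHE ∷ []
  startTrav atE with baseS
  ... | atE = []
  ... | atV = baseHE ∷ []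

  OutcomeE : Side → (Fin nE → ℕ) → Sub → Set
  OutcomeE c f R = Run (λ G → HypertreeE G f) Bip (startHE c) (startTrav c) R

  OutcomeV : Side → (Fin nV → ℕ) → Sub → Set
  OutcomeV c f R = Run (λ G → HypertreeV G f) Bip (startHE c) (startTrav c) R

  InOutcomesE : Side → Sub → Set
  InOutcomesE c T = Σ (Fin nE → ℕ) λ f → HypertreeE Bip f × Σ Sub λ R → OutcomeE c f R × (R ≐ T)

  InOutcomesV : Side → Sub → Set
  InOutcomesV c T = Σ (Fin nV → ℕ) λ f → HypertreeV Bip f × Σ Sub λ R → OutcomeV c f R × (R ≐ T)

{-# OPTIONS --safe #-}
-- The tour of a spanning tree T is a single cycle through all half-edges, and the far side of a
-- tree edge is visited in one block, from the first to the second time the edge is met.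
--
-- Let T be a Jaeger tree with degree vector f on X. The process for f deletes exactly the non-edges
-- of T. Suppose it stands at an edge h of T, met at its cut-coloured end. If h was met before, the
-- current graph has no other edge between the two sides of T - h. If not, all such edges have their
-- cut-coloured end on the far side; then the nodes of X on one side of h are incident in T to one
-- edge more than a forest of the current graph avoiding h can give them. Either way h stays.
--
-- Conversely, every hypertree f is realised by a Jaeger tree. If a realisation T has a non-edge q met
-- first at its wrong end, exchange q for the first edge g of the fundamental cycle of q at the end of q
-- in X. This keeps the degrees on X, and the tours agree until q or g is met; by the block property g
-- is not met at its wrong end before q, so a lexicographic penalty drops. As the process is
-- deterministic, its outcome for f is the Jaeger tree so obtained.
module Submission where

open import Defs
open import Data.Bool using (Bool; true; false; if_then_else_; _∧_; not)
import Data.Bool.Properties as Bool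
open import Data.Empty using (⊥; ⊥-elim)
open import Data.Fin using (Fin; zero; suc; _≟_; toℕ; combine)
import Data.Fin.Properties as Fin
open import Data.Fin.Properties using (pigeonhole; toℕ<n; combine-injective)
open import Data.List using (List; []; _∷_; _++_; [_]; reverse)
open import Data.List.Membership.Propositional using (_∈_; _∉_)
open import Data.List.Membership.Propositional.Properties using (∈-++⁺ˡ; ∈-++⁺ʳ; ∈-++⁻)
open import Data.List.Properties using (unfold-reverse; ++-assoc; ++-identityʳ; ∷ʳ-injective)
open import Data.List.Relation.Unary.All using (lookup)
open import Data.List.Relation.Unary.AllPairs using (_∷_)
open import Data.List.Relation.Unary.Any using (here; there)
open import Data.List.Relation.Unary.Unique.Propositional using (Unique)
open import Data.Maybe using (just; fromMaybe)
open import Data.Nat using (ℕ; zero; suc; _+_; _*_; _∸_; _≤_; _<_; z≤n; s≤s; z<s; s<s; s≤s⁻¹)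
open import Data.Nat.Properties hiding (_≟_)
open import Algebra.Properties.CommutativeMonoid.Sum +-0-commutativeMonoid using (sum; sum-cong-≗; ∑-comm)
open import Data.Product using (Σ; ∃; ∃₂; _×_; _,_; proj₁; proj₂)
import Data.Product.Properties as Product
open import Data.Sum using (_⊎_; inj₁; inj₂)
import Data.Sum.Properties as Sum
open import Function using (_∘_)
open import Function.Bundles using (_⇔_; mk⇔; Equivalence)
open import Relation.Binary.Definitions using (DecidableEquality; tri<; tri≈; tri>)
open import Relation.Binary.PropositionalEquality hiding ([_])
open import Relation.Nullary using (¬_; Dec; does; yes; no; contradiction)
open import Relation.Nullary.Decidable using (dec-true; dec-false; map′; _×-dec_; _⊎-dec_)
open import Relation.Unary using (Decidable)

true≢false : ∀ {b} → b ≡ true → b ≢ false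
true≢false refl ()

-- Cyclic orders given by lists.

scan : ∀ {n} → Fin n → List (Fin n) → List (Fin n) → List (Fin n) → List (Fin n)
scan y L pre [] = L
scan y L pre (z ∷ zs) with does (z ≟ y)
... | true = zs ++ reverse pre ++ [ y ]
... | false = scan y L (z ∷ pre) zs

-- The underscore is solved to the local worker of rotAfter, which cannot be named from outside.
mutual
  worker≡scan : ∀ {n} (y : Fin n) L pre zs → _ ≡ scan y L pre zs

  rotAfter≡scan : ∀ {n} (y : Fin n) L → rotAfter y L ≡ scan y L [] L
  rotAfter≡scan y [] = refl
  rotAfter≡scan y (z ∷ zs) with does (z ≟ y)
  ... | true = refl
  -- Abstracting the accumulator and the list to variables leaves the underscore applied to distinct
  -- variables, so unification has a unique solution.
  ... | false with z ∷ [] | z ∷ zs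
  ... | pre | L = worker≡scan y L pre zs

  worker≡scan y L pre [] = refl
  worker≡scan y L pre (z ∷ zs) with does (z ≟ y)
  ... | true = refl
  ... | false = worker≡scan y L (z ∷ pre) zs

scan-split : ∀ {n} (y : Fin n) L acc pre post → y ∉ pre →
  scan y L acc (pre ++ y ∷ post) ≡ post ++ reverse acc ++ pre ++ [ y ]
scan-split y L acc [] post y∉ with y ≟ y
... | yes _ = refl
... | no y≢y = contradiction refl y≢y
scan-split y L acc (x ∷ pre) post y∉ with x ≟ y
... | yes x≡y = contradiction (here (sym x≡y)) y∉
... | no _ = trans (scan-split y L (x ∷ acc) pre post (λ y∈ → y∉ (there y∈)))
  (cong (post ++_) (trans (cong (_++ pre ++ [ y ]) (unfold-reverse x acc))
                          (++-assoc (reverse acc) [ x ] (pre ++ [ y ]))))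

rotAfter-split : ∀ {n} (y : Fin n) pre post → y ∉ pre →
  rotAfter y (pre ++ y ∷ post) ≡ post ++ pre ++ [ y ]
rotAfter-split y pre post y∉ =
  trans (rotAfter≡scan y (pre ++ y ∷ post)) (scan-split y (pre ++ y ∷ post) [] pre post y∉)

Unique-++⇒∉ : ∀ {n} {z : Fin n} xs {ys} → Unique (xs ++ z ∷ ys) → z ∉ xs
Unique-++⇒∉ (x ∷ xs) (x≢ ∷ u) (here refl) = lookup x≢ (∈-++⁺ʳ xs (here refl)) refl
Unique-++⇒∉ (x ∷ xs) (x≢ ∷ u) (there z∈) = Unique-++⇒∉ xs u z∈

first-split : ∀ {n} {y : Fin n} {L} → y ∈ L → ∃₂ λ pre post → L ≡ pre ++ y ∷ post
first-split (here {xs = xs} refl) = [] , xs , refl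
first-split (there {x = x} y∈) with first-split y∈
... | pre , post , refl = x ∷ pre , post , refl

-- The last entry of a rotation recovers `y`, which makes the successor map injective; that no entry
-- of `L` is lost guarantees that a search along the rotation succeeds.
rotAfter-ends : ∀ {n} {y : Fin n} {L} → Unique L → y ∈ L →
  ∃ λ Q → rotAfter y L ≡ Q ++ [ y ] × (∀ {z} → z ∈ L → z ∈ rotAfter y L)
rotAfter-ends {y = y} u y∈ with first-split y∈
... | pre , post , refl = post ++ pre , trans eq (sym (++-assoc post pre [ y ])) ,
        λ z∈ → subst (_ ∈_) (sym eq) (move (∈-++⁻ pre z∈))
  where
  eq = rotAfter-split y pre post (Unique-++⇒∉ pre u)
  move : ∀ {z} → _ → z ∈ post ++ pre ++ [ y ]
  move (inj₁ z∈) = ∈-++⁺ʳ post (∈-++⁺ˡ z∈)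
  move (inj₂ (here refl)) = ∈-++⁺ʳ post (∈-++⁺ʳ pre (here refl))
  move (inj₂ (there z∈)) = ∈-++⁺ˡ z∈

-- Advancing to the successor shifts the cycle by one place: the head moves to the end. The cases
-- are `y` alone, `y` last so that the order wraps around, and `y` followed by another entry.
rotAfter-next : ∀ {n} {y : Fin n} {L} → Unique L → y ∈ L →
  ∃₂ λ z M → rotAfter y L ≡ z ∷ M × rotAfter z L ≡ M ++ [ z ] × z ∈ L
rotAfter-next {y = y} u y∈ with first-split y∈
... | [] , [] , refl = y , [] , eq , eq , here refl
  where eq = rotAfter-split y [] [] (λ ())
... | p ∷ pre , [] , refl = p , pre ++ [ y ] , rotAfter-split y (p ∷ pre) [] (Unique-++⇒∉ (p ∷ pre) u) ,
        rotAfter-split p [] (pre ++ [ y ]) (λ ()) , here refl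
... | pre , z ∷ post , refl = z , post ++ pre ++ [ y ] , rotAfter-split y pre (z ∷ post) (Unique-++⇒∉ pre u) ,
        trans (cong (rotAfter z) assoc)
          (trans (rotAfter-split z (pre ++ [ y ]) post (Unique-++⇒∉ (pre ++ [ y ]) (subst Unique assoc u)))
                 (sym (++-assoc post (pre ++ [ y ]) [ z ]))) ,
        ∈-++⁺ʳ pre (there (here refl))
  where
  assoc = sym (++-assoc pre [ y ] (z ∷ post))

module _ (H : RibbonHG) where

  iter-shift : ∀ {A : Set} (g : A → A) m a → iter H g m (g a) ≡ g (iter H g m a)
  iter-shift g zero a = refl
  iter-shift g (suc m) a = cong g (iter-shift g m a)

  module Rotation {n} {L : List (Fin n)} (u : Unique L)
                  {B : Fin n → Bool} (B-true : ∀ {z} → z ∈ L → B z ≡ true) where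

    -- The immediate successor in the full cyclic order, because `B` accepts every entry of `L`.
    ν : Fin n → Fin n
    ν = succIn B L

    private
      ν-head : ∀ {y z M} → rotAfter y L ≡ z ∷ M → z ∈ L → ν y ≡ z
      ν-head {y} eq z∈ rewrite eq | B-true z∈ = refl

    ν-∈ : ∀ {y} → y ∈ L → ν y ∈ L
    ν-∈ y∈ with rotAfter-next u y∈
    ... | z , M , eq , _ , z∈ = subst (_∈ L) (sym (ν-head eq z∈)) z∈

    -- The successor determines its own rotation, hence that of its predecessor, and the predecessor
    -- is the last entry of the latter.
    ν-injective : ∀ {x y} → x ∈ L → y ∈ L → ν x ≡ ν y → x ≡ y
    ν-injective {x} {y} x∈ y∈ νx≡νy
      with rotAfter-next u x∈ | rotAfter-next u y∈ | rotAfter-ends u x∈ | rotAfter-ends u y∈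
    ... | z , M , ex , ez , z∈ | w , N , ey , ew , w∈ | Q , fx , _ | R , fy , _
      with trans (sym (ν-head ex z∈)) (trans νx≡νy (ν-head ey w∈))
    ... | refl = proj₂ (∷ʳ-injective Q R (trans (sym fx) (trans ex
                   (trans (cong (z ∷_) (proj₁ (∷ʳ-injective M N (trans (sym ez) ew)))) (trans (sym ey) fy)))))

    -- Ties the restricted cyclic order of a subgraph to the full one. The witness `z` ensures that
    -- the search succeeds, so the default value in `succIn` never occurs.
    succIn-iter : ∀ (P : Fin n → Bool) {x z} → x ∈ L → z ∈ L → P z ≡ true →
      ∃ λ m → succIn P L x ≡ iter H ν m (ν x) × P (succIn P L x) ≡ true ×
              (∀ j → j < m → P (iter H ν j (ν x)) ≡ false)
    succIn-iter P {x} {z} x∈ z∈ Pz with rotAfter-ends u x∈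
    ... | _ , _ , into with walk (rotAfter x L) [] x∈ (sym (++-identityʳ _)) (into z∈)
      where
      -- `M` is the part of the rotation still to be searched; `N` is the rejected part, which the
      -- shifts have moved to the end.
      walk : ∀ M N {y} → y ∈ L → rotAfter y L ≡ M ++ N → z ∈ M →
        ∃ λ m → firstSat P M ≡ just (iter H ν m (ν y)) × P (iter H ν m (ν y)) ≡ true ×
                (∀ j → j < m → P (iter H ν j (ν y)) ≡ false)
      walk (w ∷ M) N {y} y∈ eq z∈M with rotAfter-next u y∈
      ... | w′ , M′ , eq′ , shift , w∈ with trans (sym eq) eq′
      ... | refl with ν-head eq′ w∈ | P w in Pw
      ... | refl | true = 0 , refl , Pw , λ _ ()
      ... | refl | false with z∈M
      ... | here refl with () ← trans (sym Pz) Pw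
      ... | there z∈
        with walk M (N ++ [ w ]) w∈ (trans shift (++-assoc M N [ w ])) z∈
      ... | m , found , Pm , before =
        suc m , trans found (cong just (iter-shift ν m (ν y))) , trans (cong P (sym (iter-shift ν m (ν y)))) Pm , λ where
          zero _ → Pw
          (suc j) (s<s j<m) → trans (cong P (sym (iter-shift ν j (ν y)))) (before j j<m)
    ... | m , found , Pm , before = m , eq , trans (cong P eq) Pm , before
      where
      eq : succIn P L x ≡ iter H ν m (ν x)
      eq = cong (fromMaybe x) found

    -- The case of `succIn-iter` in which the search is for the single value `y`.
    ν-orbit : ∀ {x y} → x ∈ L → y ∈ L → ∃ λ m → y ≡ iter H ν m (ν x)
    ν-orbit {x} {y} x∈ y∈ with succIn-iter (λ w → does (w ≟ y)) x∈ y∈ (dec-true (y ≟ y) refl)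
    ... | m , eq , hit , _ with iter H ν m (ν x) in eq′ | succIn (λ w → does (w ≟ y)) L x
    ν-orbit {x} {y} x∈ y∈ | m , refl , hit , _ | w | .w with w ≟ y
    ... | yes refl = m , sym eq′

-- Finite search, counting and binary words.

all-or-some : ∀ {n} {P Q : Fin n → Set} → (∀ i → P i ⊎ Q i) → (∀ i → P i) ⊎ ∃ Q
all-or-some {zero} d = inj₁ λ ()
all-or-some {suc n} d with d zero
... | inj₂ q = inj₂ (zero , q)
... | inj₁ p with all-or-some (d ∘ suc)
...   | inj₂ (i , q) = inj₂ (suc i , q)
...   | inj₁ ps = inj₁ λ where
        zero → p
        (suc i) → ps i

bit : Bool → ℕ
bit b = if b then 1 else 0

countF≡sum : ∀ n P → countF n P ≡ sum {n} (bit ∘ P)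
countF≡sum zero P = refl
countF≡sum (suc n) P = cong (bit (P zero) +_) (countF≡sum n (P ∘ suc))

sum-suc-at : ∀ {n} {f g : Fin n → ℕ} i → f i ≡ suc (g i) → (∀ j → j ≢ i → f j ≡ g j) →
  sum f ≡ suc (sum g)
sum-suc-at zero fi f≗g = cong₂ _+_ fi (sum-cong-≗ (λ j → f≗g (suc j) λ ()))
sum-suc-at {g = g} (suc i) fi f≗g = trans
  (cong₂ _+_ (f≗g zero λ ()) (sum-suc-at i fi (λ j j≢i → f≗g (suc j) (j≢i ∘ Fin.suc-injective))))
  (+-suc (g zero) _)

sum-mono-≤ : ∀ {n} {f g : Fin n → ℕ} → (∀ i → f i ≤ g i) → sum f ≤ sum g
sum-mono-≤ {zero} f≤g = z≤n
sum-mono-≤ {suc n} f≤g = +-mono-≤ (f≤g zero) (sum-mono-≤ (f≤g ∘ suc))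

countF-cong : ∀ n {P Q} → (∀ i → P i ≡ Q i) → countF n P ≡ countF n Q
countF-cong n {P} {Q} P≗Q = trans (countF≡sum n P)
  (trans (sum-cong-≗ (λ i → cong bit (P≗Q i))) (sym (countF≡sum n Q)))

countF-suc-at : ∀ n {P Q} i → P i ≡ true → Q i ≡ false → (∀ j → j ≢ i → P j ≡ Q j) →
  countF n P ≡ suc (countF n Q)
countF-suc-at n {P} {Q} i Pi Qi P≗Q = trans (countF≡sum n P) (trans
  (sum-suc-at i (trans (cong bit Pi) (cong (suc ∘ bit) (sym Qi))) (λ j j≢i → cong bit (P≗Q j j≢i)))
  (cong suc (sym (countF≡sum n Q))))

countF-mono : ∀ n {P Q} → (∀ i → P i ≡ true → Q i ≡ true) → countF n P ≤ countF n Q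
countF-mono n {P} {Q} P⊆Q = subst₂ _≤_ (sym (countF≡sum n P)) (sym (countF≡sum n Q))
  (sum-mono-≤ λ i → bit-mono (P i) (Q i) (P⊆Q i))
  where
  bit-mono : ∀ b c → (b ≡ true → c ≡ true) → bit b ≤ bit c
  bit-mono false c b⇒c = z≤n
  bit-mono true c b⇒c rewrite b⇒c refl = ≤-refl

countF-positive : ∀ n {P} i → P i ≡ true → ∃ λ m → countF n P ≡ suc m
countF-positive n {P} i Pi = countF n Q , countF-suc-at n i Pi
    (cong (if_then false else P i) (dec-true (i ≟ i) refl))
    (λ j j≢i → sym (cong (if_then false else P j) (dec-false (j ≟ i) j≢i)))
  where
  Q : Fin n → Bool
  Q j = if does (j ≟ i) then false else P j

countF-∧ : ∀ n {P Q : Fin n → Bool} b → countF n P ≡ countF n Q → countF n (λ i → P i ∧ b) ≡ countF n (λ i → Q i ∧ b)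
countF-∧ n {P} {Q} true eq = trans (countF-cong n (λ i → Bool.∧-identityʳ (P i)))
  (trans eq (sym (countF-cong n (λ i → Bool.∧-identityʳ (Q i)))))
countF-∧ n {P} {Q} false eq = countF-cong n λ i → trans (Bool.∧-zeroʳ (P i)) (sym (Bool.∧-zeroʳ (Q i)))

least : ∀ {P : ℕ → Set} → Decidable P → ∀ n → P n → ∃ λ m → m ≤ n × P m × (∀ k → k < m → ¬ P k)
least P? zero p = zero , z≤n , p , λ _ ()
least P? (suc n) p with P? 0
... | yes p₀ = zero , z≤n , p₀ , λ _ ()
... | no ¬p₀ with least (P? ∘ suc) n p
... | m , m≤n , pm , below = suc m , s≤s m≤n , pm , λ where
  zero _ → ¬p₀
  (suc k) (s<s k<m) → below k k<m

constant-between : ∀ (σ : ℕ → Bool) {l u} → (∀ i → l ≤ i → i < u → σ (suc i) ≡ σ i) →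
  ∀ {i} → l ≤ i → i ≤ u → σ i ≡ σ l
constant-between σ {l} stay {i} l≤i i≤u with m≤n⇒m<n∨m≡n l≤i
... | inj₂ refl = refl
constant-between σ {l} stay {suc i} l≤i i<u | inj₁ (s≤s l≤i′) =
  trans (stay i l≤i′ i<u) (constant-between σ stay l≤i′ (<⇒≤ i<u))

-- Made for a jump of the process from time `t` to time `m + suc t`: an earlier time precedes the
-- jump, is its start, or is one of the `m` times skipped.
between : ∀ {i t m} → i < m + suc t → i < t ⊎ i ≡ t ⊎ ∃ λ j → j < m × i ≡ j + suc t
between {i} {t} {m} i< with <-cmp i t
... | tri< i<t _ _ = inj₁ i<t
... | tri≈ _ i≡t _ = inj₂ (inj₁ i≡t)
... | tri> _ _ t<i = inj₂ (inj₂ (i ∸ suc t ,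
        +-cancelʳ-< (suc t) (i ∸ suc t) m (subst (_< m + suc t) (sym (m∸n+n≡m t<i)) i<) , sym (m∸n+n≡m t<i)))

-- The bit at position 0 is the most significant, so comparing values compares words of length `K`
-- lexicographically.
binary : (ℕ → Bool) → ℕ → ℕ
binary b zero = 0
binary b (suc K) = 2 * binary b K + bit (b K)

bit≤1 : ∀ b → bit b ≤ 1
bit≤1 true = ≤-refl
bit≤1 false = z≤n

binary-cong : ∀ {b b′} K → (∀ t → t < K → b t ≡ b′ t) → binary b K ≡ binary b′ K
binary-cong zero eq = refl
binary-cong (suc K) eq = cong₂ (λ m x → 2 * m + bit x)
  (binary-cong K λ t t<K → eq t (<-trans t<K (n<1+n K))) (eq K (n<1+n K))

-- From the first difference on, the prefixes differ by at least 1; doubling makes this at least 2,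
-- which one further bit cannot undo.
binary-lex : ∀ {b b′ k} K → k < K → (∀ t → t < k → b t ≡ b′ t) → b k ≡ false → b′ k ≡ true →
  binary b K < binary b′ K
binary-lex {b} {b′} {k} (suc K) k<1+K eq bk b′k with m≤n⇒m<n∨m≡n (s≤s⁻¹ k<1+K)
... | inj₂ refl rewrite bk | b′k | binary-cong {b} {b′} K eq = +-monoʳ-< (2 * binary b′ K) z<s
... | inj₁ k<K = begin-strict
    2 * binary b K + bit (b K)   ≤⟨ +-monoʳ-≤ (2 * binary b K) (bit≤1 (b K)) ⟩
    2 * binary b K + 1           <⟨ +-monoʳ-< (2 * binary b K) (n<1+n 1) ⟩
    2 * binary b K + 2           ≡⟨ +-comm (2 * binary b K) 2 ⟩
    2 + 2 * binary b K           ≡⟨ *-suc 2 (binary b K) ⟨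
    2 * suc (binary b K)         ≤⟨ *-monoʳ-≤ 2 (binary-lex K k<K eq bk b′k) ⟩
    2 * binary b′ K              ≤⟨ m≤m+n (2 * binary b′ K) (bit (b′ K)) ⟩
    2 * binary b′ K + bit (b′ K) ∎
  where open ≤-Reasoning

-- Half-edges and spanning subgraphs.

module RibbonTheory (H : RibbonHG) where
  open RibbonHG H

  infix 4 _∈ₕ_ _∉ₕ_ _⊆_

  _∈ₕ_ _∉ₕ_ : HE H → Sub H → Set
  (v , e , _) ∈ₕ G = G v e ≡ true
  (v , e , _) ∉ₕ G = G v e ≡ false

  _⊆_ : Sub H → Sub H → Set
  G ⊆ G′ = ∀ h → h ∈ₕ G → h ∈ₕ G′

  value : Sub H → HE H → Bool
  value G (v , e , _) = G v e

  src dst : HE H → Node H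
  src (v , e , atV) = inj₁ v
  src (v , e , atE) = inj₂ e
  dst h = src (flipHE H h)

  colour : HE H → Side
  colour (_ , _ , s) = s

  flip-involutive : ∀ h → flipHE H (flipHE H h) ≡ h
  flip-involutive (v , e , atV) = refl
  flip-involutive (v , e , atE) = refl

  dst-flip : ∀ h → dst (flipHE H h) ≡ src h
  dst-flip h = cong src (flip-involutive h)

  _≟ₛ_ : DecidableEquality Side
  atV ≟ₛ atV = yes refl
  atV ≟ₛ atE = no λ ()
  atE ≟ₛ atV = no λ ()
  atE ≟ₛ atE = yes refl

  ≢⇒flipSide : ∀ {s t} → s ≢ t → s ≡ flipSide t
  ≢⇒flipSide {atV} {atV} s≢t = contradiction refl s≢t
  ≢⇒flipSide {atV} {atE} s≢t = refl
  ≢⇒flipSide {atE} {atV} s≢t = refl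
  ≢⇒flipSide {atE} {atE} s≢t = contradiction refl s≢t

  flipSide≢ : ∀ s → flipSide s ≢ s
  flipSide≢ atV ()
  flipSide≢ atE ()

  flipSide-involutive : ∀ s → flipSide (flipSide s) ≡ s
  flipSide-involutive atV = refl
  flipSide-involutive atE = refl

  _≟ₕ_ : DecidableEquality (HE H)
  _≟ₕ_ = Product.≡-dec _≟_ (Product.≡-dec _≟_ _≟ₛ_)

  _≟ₙ_ : DecidableEquality (Node H)
  _≟ₙ_ = Sum.≡-dec _≟_ _≟_

  same-edge : ∀ {h k} → proj₁ k ≡ proj₁ h → proj₁ (proj₂ k) ≡ proj₁ (proj₂ h) → k ≡ h ⊎ k ≡ flipHE H h
  same-edge {v , e , s} {v , e , t} refl refl with t ≟ₛ s
  ... | yes refl = inj₁ refl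
  ... | no t≢s = inj₂ (cong (λ t → v , e , t) (≢⇒flipSide t≢s))

  ⊆-⊆ₛ : ∀ {G G′} → G ⊆ G′ → _⊆ₛ_ H G G′
  ⊆-⊆ₛ sub v e = sub (v , e , atV)

  ⊆ₛ-⊆ : ∀ {G G′} → _⊆ₛ_ H G G′ → G ⊆ G′
  ⊆ₛ-⊆ sub (v , e , _) = sub v e

  -- For b = false this unfolds to removeHE.
  setHE : Bool → Sub H → HE H → Sub H
  setHE b G (v , e , _) v′ e′ = if does (v′ ≟ v) ∧ does (e′ ≟ e) then b else G v′ e′

  addHE : Sub H → HE H → Sub H
  addHE = setHE true

  setHE-self : ∀ b G h → value (setHE b G h) h ≡ b
  setHE-self b G (v , e , _) rewrite dec-true (v ≟ v) refl | dec-true (e ≟ e) refl = refl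

  setHE-cases : ∀ b G h k →
    ((k ≡ h ⊎ k ≡ flipHE H h) × value (setHE b G h) k ≡ b) ⊎
    ((k ≢ h × k ≢ flipHE H h) × value (setHE b G h) k ≡ value G k)
  setHE-cases b G h@(v , e , s) k@(v′ , e′ , s′) with v′ ≟ v | e′ ≟ e
  ... | yes v≡ | yes e≡ = inj₁ (same-edge {h} {k} v≡ e≡ , refl)
  ... | yes _ | no e≢ = inj₂ ((e≢ ∘ cong (proj₁ ∘ proj₂) , e≢ ∘ cong (proj₁ ∘ proj₂)) , refl)
  ... | no v≢ | _ = inj₂ ((v≢ ∘ cong proj₁ , v≢ ∘ cong proj₁) , refl)

  setHE-other : ∀ b G {h k} → k ≢ h → k ≢ flipHE H h → value (setHE b G h) k ≡ value G k
  setHE-other b G {h} {k} k≢h k≢fh with setHE-cases b G h k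
  ... | inj₁ (inj₁ k≡h , _) = contradiction k≡h k≢h
  ... | inj₁ (inj₂ k≡fh , _) = contradiction k≡fh k≢fh
  ... | inj₂ (_ , eq) = eq

  removeHE-self : ∀ G h → h ∉ₕ removeHE H G h
  removeHE-self = setHE-self false

  ∈-removeHE : ∀ {G h k} → k ≢ h → k ≢ flipHE H h → k ∈ₕ G → k ∈ₕ removeHE H G h
  ∈-removeHE {G} k≢h k≢fh = trans (setHE-other false G k≢h k≢fh)

  removeHE-∈ : ∀ {G h k} → k ∈ₕ removeHE H G h → (k ≢ h × k ≢ flipHE H h) × k ∈ₕ G
  removeHE-∈ {G} {h} {k} k∈ with setHE-cases false G h k
  ... | inj₁ (_ , eq) = contradiction eq (true≢false k∈)
  ... | inj₂ (k≢ , eq) = k≢ , trans (sym eq) k∈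

  removeHE-⊆ : ∀ {G h} → removeHE H G h ⊆ G
  removeHE-⊆ {G} {h} k k∈ = proj₂ (removeHE-∈ {G} {h} {k} k∈)

  removeHE-mono : ∀ {G G′ h} → G ⊆ G′ → removeHE H G h ⊆ removeHE H G′ h
  removeHE-mono {G} {G′} {h} sub k k∈ with removeHE-∈ {G} {h} {k} k∈
  ... | (k≢h , k≢fh) , k∈G = ∈-removeHE {G′} {h} {k} k≢h k≢fh (sub k k∈G)

  addHE-∈ : ∀ {G h k} → k ∈ₕ addHE G h → (k ≡ h ⊎ k ≡ flipHE H h) ⊎ k ∈ₕ G
  addHE-∈ {G} {h} {k} k∈ with setHE-cases true G h k
  ... | inj₁ (k≡ , _) = inj₁ k≡
  ... | inj₂ (_ , eq) = inj₂ (trans (sym eq) k∈)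

  ⊆-addHE : ∀ {G h} → G ⊆ addHE G h
  ⊆-addHE {G} {h} k k∈ with setHE-cases true G h k
  ... | inj₁ (_ , eq) = eq
  ... | inj₂ (_ , eq) = trans eq k∈

  ⊆-add-remove : ∀ {G h} → G ⊆ addHE (removeHE H G h) h
  ⊆-add-remove {G} {h} k k∈ with setHE-cases true (removeHE H G h) h k
  ... | inj₁ (_ , eq) = eq
  ... | inj₂ ((k≢h , k≢fh) , eq) = trans eq (∈-removeHE {G} {h} {k} k≢h k≢fh k∈)

  -- Reachability.

  Adj⇒HE : ∀ {G x y} → Adj H G x y → ∃ λ h → h ∈ₕ G × src h ≡ x × dst h ≡ y
  Adj⇒HE (ve {v} {e} G∋) = (v , e , atV) , G∋ , refl , refl
  Adj⇒HE (ev {v} {e} G∋) = (v , e , atE) , G∋ , refl , refl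

  edge : ∀ {G} h → h ∈ₕ G → Reach H G (src h) (dst h)
  edge (v , e , atV) h∈ = step (ve h∈) here
  edge (v , e , atE) h∈ = step (ev h∈) here

  reach-trans : ∀ {G x y z} → Reach H G x y → Reach H G y z → Reach H G x z
  reach-trans here q = q
  reach-trans (step a p) q = step a (reach-trans p q)

  reach-sym : ∀ {G x y} → Reach H G x y → Reach H G y x
  reach-sym here = here
  reach-sym (step (ve G∋) p) = reach-trans (reach-sym p) (step (ev G∋) here)
  reach-sym (step (ev G∋) p) = reach-trans (reach-sym p) (step (ve G∋) here)

  reach-edges : ∀ {G G′ x y} → (∀ h → h ∈ₕ G → Reach H G′ (src h) (dst h)) → Reach H G x y → Reach H G′ x y
  reach-edges f here = here
  reach-edges f (step a p) with Adj⇒HE a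
  ... | h , h∈ , refl , refl = reach-trans (f h h∈) (reach-edges f p)

  reach-mono : ∀ {G G′ x y} → G ⊆ G′ → Reach H G x y → Reach H G′ x y
  reach-mono sub = reach-edges λ h h∈ → edge h (sub h h∈)

  -- `S` is a union of connected components of `G`, given as a Boolean function so that both sides
  -- are open to case analysis.
  Closed : (Node H → Bool) → Sub H → Set
  Closed S G = ∀ h → h ∈ₕ G → S (src h) ≡ S (dst h)

  reach-closed : ∀ {S G x y} → Closed S G → Reach H G x y → S x ≡ S y
  reach-closed cl here = refl
  reach-closed cl (step a p) with Adj⇒HE a
  ... | h , h∈ , refl , refl = trans (cl h h∈) (reach-closed cl p)

  reach-flip : ∀ {G} h → Reach H G (src (flipHE H h)) (dst (flipHE H h)) → Reach H G (src h) (dst h)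
  reach-flip {G} h p = reach-sym (subst (Reach H G (dst h)) (dst-flip h) p)

  ReachVia : Sub H → HE H → Node H → Node H → Set
  ReachVia G k x y = Reach H G x y ⊎ (Reach H G x (src k) × Reach H G (dst k) y)
                                   ⊎ (Reach H G x (dst k) × Reach H G (src k) y)

  -- A walk needs `k` at most once: if a later use brings it back to where it entered `k` or left
  -- it, the part in between is dropped.
  reach-addHE : ∀ {G} k {x y} → Reach H (addHE G k) x y → ReachVia G k x y
  reach-addHE k here = inj₁ here
  reach-addHE {G} k (step a p) with Adj⇒HE a
  ... | h , h∈ , refl , refl with reach-addHE {G} k p | addHE-∈ {G} {k} {h} h∈
  ... | inj₁ q | inj₂ h∈G = inj₁ (reach-trans (edge h h∈G) q)
  ... | inj₂ (inj₁ (q , r)) | inj₂ h∈G = inj₂ (inj₁ (reach-trans (edge h h∈G) q , r))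
  ... | inj₂ (inj₂ (q , r)) | inj₂ h∈G = inj₂ (inj₂ (reach-trans (edge h h∈G) q , r))
  ... | inj₁ q | inj₁ (inj₁ refl) = inj₂ (inj₁ (here , q))
  ... | inj₂ (inj₁ (q , r)) | inj₁ (inj₁ refl) = inj₂ (inj₁ (here , r))
  ... | inj₂ (inj₂ (q , r)) | inj₁ (inj₁ refl) = inj₁ r
  ... | inj₁ q | inj₁ (inj₂ refl) = inj₂ (inj₂ (here , subst (λ z → Reach H G z _) (dst-flip k) q))
  ... | inj₂ (inj₁ (q , r)) | inj₁ (inj₂ refl) = inj₁ r
  ... | inj₂ (inj₂ (q , r)) | inj₁ (inj₂ refl) = inj₂ (inj₂ (here , r))

  reach-split : ∀ {G} k {x y} → Reach H G x y → ReachVia (removeHE H G k) k x y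
  reach-split {G} k p = reach-addHE k (reach-mono (⊆-add-remove {G} {k}) p)

  -- Numbers of edges and decidability of reachability.

  size : Sub H → ℕ
  size G = sum {nV} (degV H G)

  size-suc-at : ∀ {G G′} h → h ∈ₕ G → h ∉ₕ G′ →
    (∀ k → k ≢ h → k ≢ flipHE H h → value G k ≡ value G′ k) → size G ≡ suc (size G′)
  size-suc-at {G} {G′} h@(v , e , s) h∈ h∉ same = sum-suc-at v
    (countF-suc-at nE e h∈ h∉ λ e′ e′≢e → same (v , e′ , s) (e′≢e ∘ cong (proj₁ ∘ proj₂)) (e′≢e ∘ cong (proj₁ ∘ proj₂)))
    λ v′ v′≢v → countF-cong nE λ e′ → same (v′ , e′ , s) (v′≢v ∘ cong proj₁) (v′≢v ∘ cong proj₁)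

  size-removeHE : ∀ {G} h → h ∈ₕ G → size G ≡ suc (size (removeHE H G h))
  size-removeHE {G} h h∈ = size-suc-at {G} {removeHE H G h} h h∈ (removeHE-self G h)
    λ k k≢h k≢fh → sym (setHE-other false G k≢h k≢fh)

  size-addHE : ∀ {G} h → h ∉ₕ G → size (addHE G h) ≡ suc (size G)
  size-addHE {G} h h∉ = size-suc-at {addHE G h} {G} h (setHE-self true G h) h∉
    λ k k≢h k≢fh → setHE-other true G k≢h k≢fh

  size-mono : ∀ {G G′} → G ⊆ G′ → size G ≤ size G′
  size-mono sub = sum-mono-≤ λ v → countF-mono nE λ e → sub (v , e , atV)

  all-or-some-edge : ∀ {P Q : Fin nV → Fin nE → Set} → (∀ v e → P v e ⊎ Q v e) →
    (∀ v e → P v e) ⊎ ∃₂ Q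
  all-or-some-edge d = all-or-some λ v → all-or-some (d v)

  private
    -- Induction on the number of edges: after one edge is deleted, a walk either avoids it or uses
    -- it once, in one of two directions.
    reach-dec : ∀ n G → size G ≡ n → ∀ x y → Dec (Reach H G x y)
    reach-dec n G size≡ x y with all-or-some-edge (λ v e → edge? v e)
      where
      edge? : ∀ v e → (G v e ≡ false) ⊎ (G v e ≡ true)
      edge? v e with G v e
      ... | true = inj₂ refl
      ... | false = inj₁ refl
    ... | inj₁ none = map′ (λ { refl → here }) trivial (x ≟ₙ y)
      where
      trivial : Reach H G x y → x ≡ y
      trivial here = refl
      trivial (step a p) with Adj⇒HE a
      ... | (v , e , _) , h∈ , _ = contradiction (none v e) (true≢false h∈)
    reach-dec zero G size≡ x y | inj₂ (v , e , h∈)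
      with () ← trans (sym size≡) (size-removeHE {G} (v , e , atV) h∈)
    reach-dec (suc n) G size≡ x y | inj₂ (v , e , h∈) =
      map′ join (reach-split {G} h) (rec x y ⊎-dec (rec x (src h) ×-dec rec (dst h) y)
                                           ⊎-dec (rec x (dst h) ×-dec rec (src h) y))
      where
      h : HE H
      h = v , e , atV
      G₀ = removeHE H G h
      rec = reach-dec n G₀ (suc-injective (trans (sym (size-removeHE {G} h h∈)) size≡))
      up : ∀ {x y} → Reach H G₀ x y → Reach H G x y
      up = reach-mono (removeHE-⊆ {G} {h})
      join : ReachVia G₀ h x y → Reach H G x y
      join (inj₁ p) = up p
      join (inj₂ (inj₁ (p , q))) = reach-trans (up p) (reach-trans (edge h h∈) (up q))
      join (inj₂ (inj₂ (p , q))) = reach-trans (up p) (reach-trans (reach-sym (edge h h∈)) (up q))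

  reach? : ∀ G x y → Dec (Reach H G x y)
  reach? G = reach-dec (size G) G refl

  -- The walk has to leave a component of `G` somewhere; deciding reachability edge by edge finds
  -- the place.
  crossing-edge : ∀ {C G x y} → Reach H C x y → ¬ Reach H G x y →
    ∃ λ k → k ∈ₕ C × ¬ Reach H G (src k) (dst k)
  crossing-edge here ¬p = contradiction here ¬p
  crossing-edge {C} {G} (step a p) ¬p with Adj⇒HE a
  ... | h , h∈ , refl , refl with reach? G (src h) (dst h)
  ... | no ¬q = h , h∈ , ¬q
  ... | yes q = crossing-edge p (¬p ∘ reach-trans q)

  -- Forests and rank

  -- Absence of cycles in the form that every edge is a bridge, so that closed walks need not be
  -- handled.
  Acyclic : Sub H → Set
  Acyclic F = ∀ h → h ∈ₕ F → ¬ Reach H (removeHE H F h) (src h) (dst h)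

  -- `F` lies in the closure of `C` in the graphic matroid.
  Spans : Sub H → Sub H → Set
  Spans C F = ∀ h → h ∈ₕ F → Reach H C (src h) (dst h)

  acyclic-⊆ : ∀ {F F′} → F ⊆ F′ → Acyclic F′ → Acyclic F
  acyclic-⊆ {F} {F′} sub ac h h∈ p =
    ac h (sub h h∈) (reach-mono (removeHE-mono {F} {F′} {h} sub) p)

  -- A cycle through an old edge `j` would have to use `k`, and the rest of that cycle would join
  -- the ends of `k` inside `F`.
  acyclic-addHE : ∀ {F k} → Acyclic F → ¬ Reach H F (src k) (dst k) → Acyclic (addHE F k)
  acyclic-addHE {F} {k} ac ¬p j j∈ p with setHE-cases true F k j
  ... | inj₁ (j≡ , _) = own j≡
    where
    drop : ∀ {h} → h ≡ k ⊎ h ≡ flipHE H k → removeHE H (addHE F k) h ⊆ F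
    drop {h} h≡ i i∈ with removeHE-∈ {addHE F k} {h} {i} i∈
    ... | (i≢h , i≢fh) , i∈′ with addHE-∈ {F} {k} {i} i∈′ | h≡
    ... | inj₂ i∈F | _ = i∈F
    ... | inj₁ (inj₁ i≡k) | inj₁ refl = contradiction i≡k i≢h
    ... | inj₁ (inj₂ i≡fk) | inj₁ refl = contradiction i≡fk i≢fh
    ... | inj₁ (inj₁ i≡k) | inj₂ refl = contradiction (trans i≡k (sym (flip-involutive k))) i≢fh
    ... | inj₁ (inj₂ i≡fk) | inj₂ refl = contradiction i≡fk i≢h
    own : j ≡ k ⊎ j ≡ flipHE H k → ⊥
    own (inj₁ refl) = ¬p (reach-mono (drop {k} (inj₁ refl)) p)
    own (inj₂ refl) = ¬p (reach-flip k (reach-mono (drop {flipHE H k} (inj₂ refl)) p))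
  ... | inj₂ ((j≢k , j≢fk) , eq) with reach-addHE k (reach-mono swap p)
    where
    swap : removeHE H (addHE F k) j ⊆ addHE (removeHE H F j) k
    swap i i∈ with removeHE-∈ {addHE F k} {j} {i} i∈
    ... | (i≢j , i≢fj) , i∈′ with setHE-cases true (removeHE H F j) k i | addHE-∈ {F} {k} {i} i∈′
    ... | inj₁ (_ , eq) | _ = eq
    ... | inj₂ ((i≢k , _) , _) | inj₁ (inj₁ i≡k) = contradiction i≡k i≢k
    ... | inj₂ ((_ , i≢fk) , _) | inj₁ (inj₂ i≡fk) = contradiction i≡fk i≢fk
    ... | inj₂ (_ , eq) | inj₂ i∈F = trans eq (∈-removeHE {F} {j} {i} i≢j i≢fj i∈F)
  ... | inj₁ q = ac j (trans (sym eq) j∈) q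
  ... | inj₂ (inj₁ (q , r)) = ¬p (reach-trans (reach-sym (up q)) (reach-trans (edge j (trans (sym eq) j∈)) (reach-sym (up r))))
    where
    up : ∀ {x y} → Reach H (removeHE H F j) x y → Reach H F x y
    up = reach-mono (removeHE-⊆ {F} {j})
  ... | inj₂ (inj₂ (q , r)) = ¬p (reach-trans (up r) (reach-trans (reach-sym (edge j (trans (sym eq) j∈))) (up q)))
    where
    up : ∀ {x y} → Reach H (removeHE H F j) x y → Reach H F x y
    up = reach-mono (removeHE-⊆ {F} {j})

  _∖_ : Sub H → Sub H → Sub H
  (F ∖ C) v e = F v e ∧ not (C v e)

  private
    -- The rank inequality of the graphic matroid, by exchange. An edge `f` of `F` outside `C` is
    -- replaced by an edge of `C` joining two components of `F` without `f`; the size of `F` stays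
    -- the same and one edge fewer lies outside `C`.
    rank-induction : ∀ n F C → size (F ∖ C) ≡ n → Acyclic F → Spans C F → size F ≤ size C
    rank-induction n F C size≡ ac sp with all-or-some-edge included?
      where
      included? : ∀ v e → (F v e ≡ true → C v e ≡ true) ⊎ (F v e ≡ true × C v e ≡ false)
      included? v e with F v e | C v e
      ... | false | _ = inj₁ λ ()
      ... | true | true = inj₁ λ _ → refl
      ... | true | false = inj₂ (refl , refl)
    ... | inj₁ sub = size-mono (⊆ₛ-⊆ sub)
    ... | inj₂ (v , e , f∈F , f∉C)
      with crossing-edge (sp (v , e , atV) f∈F) (ac (v , e , atV) f∈F)
    ... | k , k∈C , ¬p = exchanged n size≡
      where
      f : HE H
      f = v , e , atV
      F₀ = removeHE H F f
      F₁ = addHE F₀ k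
      k≢f : k ≢ f
      k≢f refl = true≢false k∈C f∉C
      k≢ff : k ≢ flipHE H f
      k≢ff refl = true≢false k∈C f∉C
      k∉F₀ : k ∉ₕ F₀
      k∉F₀ = Bool.¬-not λ k∈ → ¬p (edge k k∈)
      f∈F∖C : f ∈ₕ (F ∖ C)
      f∈F∖C = cong₂ (λ a b → a ∧ not b) f∈F f∉C
      f∉F₁∖C : f ∉ₕ (F₁ ∖ C)
      f∉F₁∖C = cong (_∧ not (C v e)) (trans (setHE-other true F₀ (k≢f ∘ sym) f≢fk) (removeHE-self F f))
        where
        f≢fk : f ≢ flipHE H k
        f≢fk eq = k≢ff (trans (sym (flip-involutive k)) (cong (flipHE H) (sym eq)))
      k-∈C : ∀ j → j ≡ k ⊎ j ≡ flipHE H k → j ∈ₕ C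
      k-∈C j (inj₁ refl) = k∈C
      k-∈C j (inj₂ refl) = k∈C
      elsewhere : ∀ j → j ≢ f → j ≢ flipHE H f → value (F ∖ C) j ≡ value (F₁ ∖ C) j
      elsewhere j j≢f j≢ff with setHE-cases true F₀ k j
      ... | inj₂ (_ , eq) = cong (_∧ not (value C j)) (sym (trans eq (setHE-other false F j≢f j≢ff)))
      ... | inj₁ (j≡ , _) rewrite k-∈C j j≡ = trans (Bool.∧-zeroʳ (value F j)) (sym (Bool.∧-zeroʳ (value F₁ j)))
      smaller : size (F ∖ C) ≡ suc (size (F₁ ∖ C))
      smaller = size-suc-at f f∈F∖C f∉F₁∖C elsewhere
      ac₁ : Acyclic F₁
      ac₁ = acyclic-addHE {F₀} {k} (acyclic-⊆ (removeHE-⊆ {F} {f}) ac) ¬p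
      sp₁ : Spans C F₁
      sp₁ j j∈ with addHE-∈ {F₀} {k} {j} j∈
      ... | inj₁ (inj₁ refl) = edge k k∈C
      ... | inj₁ (inj₂ refl) = edge (flipHE H k) k∈C
      ... | inj₂ j∈F₀ = sp j (removeHE-⊆ {F} {f} j j∈F₀)
      size-F₁ : size F ≡ size F₁
      size-F₁ = trans (size-removeHE {F} f f∈F) (sym (size-addHE {F₀} k k∉F₀))
      exchanged : ∀ n → size (F ∖ C) ≡ n → size F ≤ size C
      exchanged zero size≡ with () ← trans (sym size≡) smaller
      exchanged (suc n) size≡ = ≤-trans (≤-reflexive size-F₁)
        (rank-induction n F₁ C (suc-injective (trans (sym smaller) size≡)) ac₁ sp₁)

  acyclic-size≤ : ∀ {F C} → Acyclic F → Spans C F → size F ≤ size C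
  acyclic-size≤ {F} {C} = rank-induction (size (F ∖ C)) F C refl

  tree-acyclic : ∀ {T} → IsTree H T → Acyclic T
  tree-acyclic {T} (conn , min) h h∈ p = min _ _ h∈ λ x y → reconnect (reach-split h (conn x y))
    where
    reconnect : ∀ {x y} → ReachVia (removeHE H T h) h x y → Reach H (removeHE H T h) x y
    reconnect (inj₁ q) = q
    reconnect (inj₂ (inj₁ (q , r))) = reach-trans q (reach-trans p r)
    reconnect (inj₂ (inj₂ (q , r))) = reach-trans q (reach-trans (reach-sym p) r)

  -- If an edge of `T′` could be spared, a connected graph with fewer edges than `T` would span `T`,
  -- against the rank inequality.
  connected-tree : ∀ {T T′} → IsTree H T → size T ≡ size T′ → Connected H T′ → IsTree H T′
  connected-tree {T} {T′} tree size≡ conn = conn , λ v e k∈ conn₀ → <-irrefl size≡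
    (≤-trans (s≤s (acyclic-size≤ (tree-acyclic tree) (λ h _ → conn₀ (src h) (dst h))))
             (≤-reflexive (sym (size-removeHE {T′} (v , e , atV) k∈))))

  -- The fundamental cut of the tree edge `h`, with `S` as the side of its source.
  record Separation (T : Sub H) (h : HE H) : Set where
    field
      S : Node H → Bool
      closed : Closed S (removeHE H T h)
      src-side : S (src h) ≡ true
      dst-side : S (dst h) ≡ false
      near : ∀ {x} → S x ≡ true → Reach H (removeHE H T h) (src h) x
      far : ∀ {x} → S x ≡ false → Reach H (removeHE H T h) (dst h) x

  abstract
    -- `S` is decided reachability from `src h` without `h`. It is opaque so that the decision
    -- procedure does not unfold in later goals.
    separation : ∀ {T} → IsTree H T → ∀ {h} → h ∈ₕ T → Separation T h
    separation {T} tree {h} h∈ = record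
      { S = λ x → does (r? x)
      ; closed = λ k k∈ → closed k k∈
      ; src-side = dec-true (r? (src h)) here
      ; dst-side = dec-false (r? (dst h)) (tree-acyclic tree h h∈)
      ; near = λ {x} → near x
      ; far = λ {x} → far x
      }
      where
      T₀ : Sub H
      T₀ = removeHE H T h
      r? : ∀ x → Dec (Reach H T₀ (src h) x)
      r? = reach? T₀ (src h)
      closed : Closed (λ x → does (r? x)) T₀
      closed k k∈ with r? (src k)
      ... | yes p = sym (dec-true (r? (dst k)) (reach-trans p (edge k k∈)))
      ... | no ¬p = sym (dec-false (r? (dst k)) λ q → ¬p (reach-trans q (reach-sym (edge k k∈))))
      near : ∀ x → does (r? x) ≡ true → Reach H T₀ (src h) x
      near x eq with r? x
      ... | yes p = p
      far : ∀ x → does (r? x) ≡ false → Reach H T₀ (dst h) x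
      far x eq with r? x
      ... | no ¬p with reach-split {T} h (proj₁ tree (src h) x)
      ... | inj₁ p = contradiction p ¬p
      ... | inj₂ (inj₁ (_ , p)) = p
      ... | inj₂ (inj₂ (_ , p)) = contradiction p ¬p

  -- The tour of a spanning tree

  Valid : HE H → Set
  Valid h = h ∈ₕ Bip H

  ρ : HE H → HE H
  ρ = succG H (Bip H)

  module RotV (v : Fin nV) = Rotation H (rotV-unique v) {inc v} (Equivalence.to (rotV-inc v _))
  module RotE (e : Fin nE) = Rotation H (rotE-unique e) {λ v → inc v e} (Equivalence.to (rotE-inc e _))

  ∈rotV : ∀ {v e} → inc v e ≡ true → e ∈ rotV v
  ∈rotV = Equivalence.from (rotV-inc _ _)

  ∈rotE : ∀ {v e} → inc v e ≡ true → v ∈ rotE e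
  ∈rotE = Equivalence.from (rotE-inc _ _)

  src-succG : ∀ G h → src (succG H G h) ≡ src h
  src-succG G (v , e , atV) = refl
  src-succG G (v , e , atE) = refl

  colour-succG : ∀ G h → colour (succG H G h) ≡ colour h
  colour-succG G (v , e , atV) = refl
  colour-succG G (v , e , atE) = refl

  ρ-valid : ∀ {h} → Valid h → Valid (ρ h)
  ρ-valid {v , e , atV} h∈ = Equivalence.to (rotV-inc v _) (RotV.ν-∈ v (∈rotV h∈))
  ρ-valid {v , e , atE} h∈ = Equivalence.to (rotE-inc e _) (RotE.ν-∈ e (∈rotE h∈))

  ρ-injective : ∀ {h k} → Valid h → Valid k → ρ h ≡ ρ k → h ≡ k
  ρ-injective {v , e , atV} {v′ , e′ , atV} h∈ k∈ eq with cong proj₁ eq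
  ... | refl = cong (λ e → v , e , atV) (RotV.ν-injective v (∈rotV h∈) (∈rotV k∈) (cong (proj₁ ∘ proj₂) eq))
  ρ-injective {v , e , atE} {v′ , e′ , atE} h∈ k∈ eq with cong (proj₁ ∘ proj₂) eq
  ... | refl = cong (λ v → v , e , atE) (RotE.ν-injective e (∈rotE h∈) (∈rotE k∈) (cong proj₁ eq))
  ρ-injective {v , e , atV} {v′ , e′ , atE} h∈ k∈ ()
  ρ-injective {v , e , atE} {v′ , e′ , atV} h∈ k∈ ()

  iter-ρV : ∀ m v e → iter H ρ m (v , e , atV) ≡ (v , iter H (RotV.ν v) m e , atV)
  iter-ρV zero v e = refl
  iter-ρV (suc m) v e = cong ρ (iter-ρV m v e)

  iter-ρE : ∀ m v e → iter H ρ m (v , e , atE) ≡ (iter H (RotE.ν e) m v , e , atE)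
  iter-ρE zero v e = refl
  iter-ρE (suc m) v e = cong ρ (iter-ρE m v e)

  -- Translates a step in the current graph into steps of the full ribbon structure; the half-edges
  -- passed over are those already deleted.
  succG-iter : ∀ {G h} → G ⊆ Bip H → h ∈ₕ G →
    ∃ λ m → succG H G h ≡ iter H ρ m (ρ h) × succG H G h ∈ₕ G × (∀ j → j < m → iter H ρ j (ρ h) ∉ₕ G)
  succG-iter {G} {h@(v , e , atV)} sub h∈ with RotV.succIn-iter v (G v) (∈rotV (sub h h∈)) (∈rotV (sub h h∈)) h∈
  ... | m , eq , ∈G , before = m ,
    trans (cong (λ e → v , e , atV) eq) (sym (iter-ρV m v _)) , ∈G ,
    λ j j<m → trans (cong (value G) (iter-ρV j v _)) (before j j<m)
  succG-iter {G} {h@(v , e , atE)} sub h∈ with RotE.succIn-iter e (λ w → G w e) (∈rotE (sub h h∈)) (∈rotE (sub h h∈)) h∈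
  ... | m , eq , ∈G , before = m ,
    trans (cong (λ v → v , e , atE) eq) (sym (iter-ρE m _ e)) , ∈G ,
    λ j j<m → trans (cong (value G) (iter-ρE j _ e)) (before j j<m)

  ρ-orbit : ∀ {h k} → Valid h → Valid k → src h ≡ src k → ∃ λ m → k ≡ iter H ρ m (ρ h)
  ρ-orbit {v , e , atV} {.v , e′ , atV} h∈ k∈ refl with RotV.ν-orbit v (∈rotV h∈) (∈rotV k∈)
  ... | m , eq = m , trans (cong (λ e → v , e , atV) eq) (sym (iter-ρV m v _))
  ρ-orbit {v , e , atE} {v′ , .e , atE} h∈ k∈ refl with RotE.ν-orbit e (∈rotE h∈) (∈rotE k∈)
  ... | m , eq = m , trans (cong (λ v → v , e , atE) eq) (sym (iter-ρE m _ e))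

  side-code : Side → Fin 2
  side-code atV = zero
  side-code atE = suc zero

  -- The number of codes of half-edges. It bounds the period of every tour and so gives a common
  -- length for the penalty words of all trees.
  HE-count : ℕ
  HE-count = nV * (nE * 2)

  encode : HE H → Fin HE-count
  encode (v , e , s) = combine v (combine e (side-code s))

  encode-injective : ∀ {h k} → encode h ≡ encode k → h ≡ k
  encode-injective {v , e , s} {v′ , e′ , s′} eq with combine-injective v _ v′ _ eq
  ... | refl , eq′ with combine-injective e _ e′ _ eq′
  ... | refl , eq″ = cong (λ s → v , e , s) (code-injective eq″)
    where
    code-injective : ∀ {s t} → side-code s ≡ side-code t → s ≡ t
    code-injective {atV} {atV} _ = refl
    code-injective {atE} {atE} _ = refl

  module TreeTour (T : Sub H) (T⊆ : T ⊆ Bip H) (tree : IsTree H T) where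

    τ : HE H → HE H
    τ = tourStep H T

    τ-in : ∀ {h} → h ∈ₕ T → τ h ≡ ρ (flipHE H h)
    τ-in h∈ rewrite h∈ = refl

    τ-out : ∀ {h} → h ∉ₕ T → τ h ≡ ρ h
    τ-out h∉ rewrite h∉ = refl

    ∈∨∉ : ∀ (G : Sub H) h → h ∈ₕ G ⊎ h ∉ₕ G
    ∈∨∉ G h with value G h
    ... | true = inj₁ refl
    ... | false = inj₂ refl

    src-τ-in : ∀ {h} → h ∈ₕ T → src (τ h) ≡ dst h
    src-τ-in {h} h∈ = trans (cong src (τ-in {h} h∈)) (src-succG (Bip H) (flipHE H h))

    src-τ-out : ∀ {h} → h ∉ₕ T → src (τ h) ≡ src h
    src-τ-out {h} h∉ = trans (cong src (τ-out {h} h∉)) (src-succG (Bip H) h)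

    τ-valid : ∀ {h} → Valid h → Valid (τ h)
    τ-valid {h} h∈ with ∈∨∉ T h
    ... | inj₁ h∈T = subst Valid (sym (τ-in {h} h∈T)) (ρ-valid {flipHE H h} h∈)
    ... | inj₂ h∉T = subst Valid (sym (τ-out {h} h∉T)) (ρ-valid {h} h∈)

    flip-injective : ∀ {h k} → flipHE H h ≡ flipHE H k → h ≡ k
    flip-injective {h} {k} eq = trans (sym (flip-involutive h)) (trans (cong (flipHE H) eq) (flip-involutive k))

    -- In the mixed case injectivity of `ρ` identifies the two edges, and the common edge would be
    -- both in `T` and outside it.
    τ-injective : ∀ {h k} → Valid h → Valid k → τ h ≡ τ k → h ≡ k
    τ-injective {h} {k} hv kv eq with ∈∨∉ T h | ∈∨∉ T k
    ... | inj₁ h∈ | inj₁ k∈ = flip-injective (ρ-injective {flipHE H h} {flipHE H k} hv kv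
            (trans (sym (τ-in {h} h∈)) (trans eq (τ-in {k} k∈))))
    ... | inj₂ h∉ | inj₂ k∉ = ρ-injective {h} {k} hv kv (trans (sym (τ-out {h} h∉)) (trans eq (τ-out {k} k∉)))
    ... | inj₁ h∈ | inj₂ k∉ with ρ-injective {flipHE H h} {k} hv kv (trans (sym (τ-in {h} h∈)) (trans eq (τ-out {k} k∉)))
    ...   | refl = contradiction k∉ (true≢false h∈)
    τ-injective {h} {k} hv kv eq | inj₂ h∉ | inj₁ k∈
      with ρ-injective {h} {flipHE H k} hv kv (trans (sym (τ-out {h} h∉)) (trans eq (τ-in {k} k∈)))
    ...   | refl = contradiction h∉ (true≢false k∈)

    pos : ℕ → HE H
    pos = tour H T

    pos-valid : ∀ i → Valid (pos i)
    pos-valid zero = base-inc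
    pos-valid (suc i) = τ-valid {pos i} (pos-valid i)

    pos-cancel : ∀ i {d} → pos i ≡ pos (i + d) → baseHE H ≡ pos d
    pos-cancel zero eq = eq
    pos-cancel (suc i) {d} eq = pos-cancel i (τ-injective {pos i} {pos (i + d)} (pos-valid i) (pos-valid (i + d)) eq)

    abstract
      -- Two early positions coincide by the pigeonhole principle, and injectivity of the tour step
      -- carries the coincidence back to the start.
      returns : ∃ λ d → d < HE-count × pos (suc d) ≡ baseHE H
      returns with pigeonhole (n<1+n HE-count) (encode ∘ pos ∘ toℕ)
      ... | i , j , i<j , eq with m<n⇒0<n∸m i<j | m+[n∸m]≡n (<⇒≤ i<j)
      ... | 0<d | i+d≡j with toℕ j ∸ toℕ i | s≤s⁻¹ (≤-trans (s≤s (m∸n≤m (toℕ j) (toℕ i))) (toℕ<n j))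
      ... | suc d | d≤K = d , d≤K ,
        sym (pos-cancel (toℕ i) (trans (encode-injective eq) (cong pos (sym i+d≡j))))

      first-return : ∃ λ m → m ≤ proj₁ returns × pos (suc m) ≡ baseHE H × (∀ k → k < m → pos (suc k) ≢ baseHE H)
      first-return = least (λ m → pos (suc m) ≟ₕ baseHE H) (proj₁ returns) (proj₂ (proj₂ returns))

    period : ℕ
    period = suc (proj₁ first-return)

    period≤ : period ≤ HE-count
    period≤ = ≤-trans (s≤s (proj₁ (proj₂ first-return))) (proj₁ (proj₂ returns))

    pos-period : ∀ i → pos (i + period) ≡ pos i
    pos-period zero = proj₁ (proj₂ (proj₂ first-return))
    pos-period (suc i) = cong τ (pos-period i)

    returns-late : ∀ {i} → 0 < i → pos i ≡ baseHE H → period ≤ i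
    returns-late {suc i} _ eq = s≤s (≮⇒≥ λ i< → proj₂ (proj₂ (proj₂ first-return)) i i< eq)

    At : ℕ → HE H → Set
    At i h = i < period × pos i ≡ h

    repeats-late : ∀ {i j} → i < j → pos i ≡ pos j → i + period ≤ j
    repeats-late {i} {j} i<j eq = subst (i + period ≤_) (m+[n∸m]≡n (<⇒≤ i<j)) (+-monoʳ-≤ i
      (returns-late (m<n⇒0<n∸m i<j) (sym (pos-cancel i (trans eq (cong pos (sym (m+[n∸m]≡n (<⇒≤ i<j)))))))))

    At-unique : ∀ {i j h} → At i h → At j h → i ≡ j
    At-unique {i} {j} (i<p , eqi) (j<p , eqj) with <-cmp i j
    ... | tri≈ _ i≡j _ = i≡j
    ... | tri< i<j _ _ = contradiction (≤-trans (m≤n+m period i) (repeats-late i<j (trans eqi (sym eqj)))) (<⇒≱ j<p)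
    ... | tri> _ _ j<i = contradiction (≤-trans (m≤n+m period j) (repeats-late j<i (trans eqj (sym eqi)))) (<⇒≱ i<p)

    At-total : ∀ i → ∃ λ j → At j (pos i)
    At-total zero = 0 , z<s , refl
    At-total (suc i) with At-total i
    ... | j , j<p , eq with m≤n⇒m<n∨m≡n j<p
    ... | inj₁ 1+j<p = suc j , 1+j<p , cong τ eq
    ... | inj₂ refl = 0 , z<s , trans (sym (pos-period 0)) (cong τ eq)

    -- A tour step rotates about a node or follows a tree edge, and among tree edges only `h` joins
    -- the two sides.
    crosses : ∀ {h} (sep : Separation T h) → let open Separation sep in
      ∀ {k} → k ≢ h → k ≢ flipHE H h → S (src (τ k)) ≡ S (src k)
    crosses {h} sep {k} k≢h k≢fh with ∈∨∉ T k
    ... | inj₁ k∈ = trans (cong S (src-τ-in {k} k∈)) (sym (closed k (∈-removeHE {T} {h} {k} k≢h k≢fh k∈)))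
      where open Separation sep
    ... | inj₂ k∉ = cong (Separation.S sep) (src-τ-out {k} k∉)

    Visited : HE H → Set
    Visited h = ∃ λ i → pos i ≡ h

    -- The tour is periodic, so it comes back to h, which it can only do through the same tree edge.
    visited-flip : ∀ {h} → h ∈ₕ T → Visited h → Visited (flipHE H h)
    visited-flip {h} h∈ (i , eq) = back (proj₁ first-return) (trans (cong (S ∘ src) again) src-side)
      where
      sep = separation tree {h} h∈
      open Separation sep
      again : pos (proj₁ first-return + suc i) ≡ h
      again = trans (cong pos (trans (+-suc (proj₁ first-return) i) (+-comm period i))) (trans (pos-period i) eq)
      back : ∀ d → S (src (pos (d + suc i))) ≡ true → Visited (flipHE H h)
      back zero at-src = contradiction
        (trans (cong (S ∘ src ∘ τ) eq) (trans (cong S (src-τ-in {h} h∈)) dst-side)) (true≢false at-src)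
      back (suc d) at-src with pos (d + suc i) ≟ₕ h | pos (d + suc i) ≟ₕ flipHE H h
      ... | _ | yes eq = d + suc i , eq
      ... | yes eq | _ = back d (trans (cong (S ∘ src) eq) src-side)
      ... | no ≢h | no ≢fh = back d (trans (sym (crosses sep ≢h ≢fh)) at-src)

    -- At a tree edge the tour first leaves for the other end; it turns to the next edge at the node
    -- when it comes back through the same edge.
    visited-ρ : ∀ {h} → Visited h → Visited (ρ h)
    visited-ρ {h} (i , eq) with ∈∨∉ T h
    ... | inj₂ h∉ = suc i , trans (cong τ eq) (τ-out {h} h∉)
    ... | inj₁ h∈ with visited-flip {h} h∈ (i , eq)
    ... | j , eq′ = suc j , trans (cong τ eq′) (trans (τ-in {flipHE H h} h∈) (cong ρ (flip-involutive h)))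

    visited-node : ∀ {h k} → Visited h → Valid h → Valid k → src h ≡ src k → Visited k
    visited-node {h} {k} vis hv kv same with ρ-orbit {h} {k} hv kv same
    ... | m , refl = around m
      where
      around : ∀ m → Visited (iter H ρ m (ρ h))
      around zero = visited-ρ vis
      around (suc m) = visited-ρ (around m)

    visited-all : ∀ {k} → Valid k → Visited k
    visited-all {k} kv = travel (proj₁ tree (src (baseHE H)) (src k)) (baseHE H) base-inc refl (0 , refl) kv refl
      where
      travel : ∀ {x y} → Reach H T x y → ∀ h → Valid h → src h ≡ x → Visited h → ∀ {k} → Valid k → src k ≡ y → Visited k
      travel here h hv refl vis {k} kv eq = visited-node {h} {k} vis hv kv (sym eq)
      travel (step a p) h hv refl vis kv eq with Adj⇒HE a
      ... | g , g∈ , src≡ , refl = travel p (flipHE H g) (T⊆ g g∈) refl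
        (visited-flip {g} g∈ (visited-node {h} {g} vis hv (T⊆ g g∈) (sym src≡))) kv eq

    At-valid : ∀ {h} → Valid h → ∃ λ i → At i h
    At-valid {h} hv with visited-all {h} hv
    ... | i , refl = At-total i

    -- h is the half-edge through which the tour enters the far side of its edge, and leaves it through flip h.
    module Excursion {h} (h∈ : h ∈ₕ T) (sep : Separation T h) {a b} (At-a : At a h) (At-b : At b (flipHE H h)) (a<b : a < b) where
      open Separation sep

      private
        σ : ℕ → Bool
        σ = S ∘ src ∘ pos

        stay : ∀ i → i < period → i ≢ a → i ≢ b → σ (suc i) ≡ σ i
        stay i i<p i≢a i≢b = crosses sep (λ eq → i≢a (At-unique (i<p , eq) At-a)) (λ eq → i≢b (At-unique (i<p , eq) At-b))

      before : ∀ {i} → i ≤ a → S (src (pos i)) ≡ true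
      before i≤a = trans (const i≤a) (trans (sym (const ≤-refl)) (trans (cong (S ∘ src) (proj₂ At-a)) src-side))
        where
        const : ∀ {i} → i ≤ a → σ i ≡ σ 0
        const = constant-between σ (λ i _ i<a → stay i (<-trans i<a (proj₁ At-a)) (<⇒≢ i<a) (<⇒≢ (<-trans i<a a<b))) z≤n

      inside : ∀ {i} → a < i → i ≤ b → S (src (pos i)) ≡ false
      inside a<i i≤b = trans
        (constant-between σ (λ i a<i i<b → stay i (<-trans i<b (proj₁ At-b)) (>⇒≢ a<i) (<⇒≢ i<b)) a<i i≤b)
        (trans (cong (S ∘ src ∘ τ) (proj₂ At-a)) (trans (cong S (src-τ-in {h} h∈)) dst-side))

      after : ∀ {i} → b < i → i ≤ period → S (src (pos i)) ≡ true
      after b<i i≤p = trans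
        (constant-between σ (λ i b<i i<p → stay i i<p (>⇒≢ (<-trans a<b b<i)) (>⇒≢ b<i)) b<i i≤p)
        (trans (cong (S ∘ src ∘ τ) (proj₂ At-b)) (trans (cong S (trans (src-τ-in {flipHE H h} h∈) (dst-flip h))) src-side))

      far⇒inside : ∀ {i k} → At i k → S (src k) ≡ false → a < i × i ≤ b
      far⇒inside {i} (i<p , refl) far = ≰⇒> (λ i≤a → true≢false (before i≤a) far) ,
        ≮⇒≥ (λ b<i → true≢false (after b<i (<⇒≤ i<p)) far)

      near⇒outside : ∀ {i k} → At i k → S (src k) ≡ true → i ≤ a ⊎ b < i
      near⇒outside {i} (i<p , refl) near with i ≤? a
      ... | yes i≤a = inj₁ i≤a
      ... | no i≰a = inj₂ (≰⇒> λ i≤b → true≢false near (inside (≰⇒> i≰a) i≤b))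

    -- `ComesFirst` limits the tour by the recurrence of the base half-edge, `At` by `period`; these
    -- agree because `period` is the first return.
    first⇒ComesFirst : ∀ {i j h} → At i h → At j (flipHE H h) → i < j → ComesFirst H T h
    first⇒ComesFirst {i} {j} At-i@(i<p , eq) At-j i<j = i , eq ,
      (λ k 0<k k≤i eq′ → <⇒≱ i<p (≤-trans (returns-late 0<k eq′) k≤i)) ,
      λ k k≤i eq′ → <⇒≱ i<j (subst (_≤ i) (At-unique (≤-<-trans k≤i i<p , eq′) At-j) k≤i)

    ComesFirst⇒first : ∀ {i j h} → ComesFirst H T h → At i h → At j (flipHE H h) → i < j
    ComesFirst⇒first {i} {j} (k , eq , no-return , not-flip) At-i At-j
      with At-unique (≰⇒> (λ p≤k → no-return period z<s p≤k (pos-period 0)) , eq) At-i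
    ... | refl = ≰⇒> λ j≤i → not-flip j j≤i (proj₂ At-j)

  -- The process along a Jaeger tree

  class : Side → ℕ
  class atV = nV
  class atE = nE

  deg : ∀ X → Sub H → Fin (class X) → ℕ
  deg atV = degV H
  deg atE = degE H

  SameDeg : Side → Sub H → Sub H → Set
  SameDeg X G G′ = ∀ x → deg X G x ≡ deg X G′ x

  end : Side → Fin nV → Fin nE → Node H
  end atV v e = inj₁ v
  end atE v e = inj₂ e

  endₕ : Side → HE H → Node H
  endₕ X (v , e , _) = end X v e

  end-src : ∀ {X} h → colour h ≡ X → endₕ X h ≡ src h
  end-src (_ , _ , atV) refl = refl
  end-src (_ , _ , atE) refl = refl

  end-dst : ∀ {X} h → colour h ≢ X → endₕ X h ≡ dst h
  end-dst {atV} (_ , _ , atV) ≢X = contradiction refl ≢X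
  end-dst {atE} (_ , _ , atV) ≢X = refl
  end-dst {atV} (_ , _ , atE) ≢X = refl
  end-dst {atE} (_ , _ , atE) ≢X = contradiction refl ≢X

  -- The edges with `X`-endpoint in `D`. Their number is the sum of the `X`-degrees over `D`, so it
  -- depends on the degree vector alone.
  restrict : Side → (Node H → Bool) → Sub H → Sub H
  restrict X D G v e = G v e ∧ D (end X v e)

  ∈-restrict : ∀ {X D G} h → h ∈ₕ G → D (endₕ X h) ≡ true → h ∈ₕ restrict X D G
  ∈-restrict h h∈ d = cong₂ _∧_ h∈ d

  restrict-∈ : ∀ {X D G} h → h ∈ₕ restrict X D G → h ∈ₕ G × D (endₕ X h) ≡ true
  restrict-∈ {X} {D} {G} h h∈ with value G h | D (endₕ X h) | h∈
  ... | true | true | refl = refl , refl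

  size-degE : ∀ G → size G ≡ sum (degE H G)
  size-degE G = trans (sum-cong-≗ (λ v → countF≡sum nE (G v)))
    (trans (∑-comm (λ v e → bit (G v e))) (sum-cong-≗ (λ e → sym (countF≡sum nV (λ v → G v e)))))

  restrict-size : ∀ X D {G G′} → SameDeg X G G′ → size (restrict X D G) ≡ size (restrict X D G′)
  restrict-size atV D {G} {G′} same = sum-cong-≗ (λ v → countF-∧ nE {G v} {G′ v} (D (inj₁ v)) (same v))
  restrict-size atE D {G} {G′} same = trans (size-degE (restrict atE D G)) (trans
    (sum-cong-≗ (λ e → countF-∧ nV {λ v → G v e} {λ v → G′ v e} (D (inj₂ e)) (same e)))
    (sym (size-degE (restrict atE D G′))))

  -- T has one more edge with its X-endpoint in D than T′ can have: those of T′ lie inside D,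
  -- where T without h already spans.
  module DegreeCount {T T′ h} (tree : IsTree H T) (h∈ : h ∈ₕ T) (sep : Separation T h) (tree′ : IsTree H T′)
                     (X : Side) (same : SameDeg X T T′) where
    open Separation sep

    impossible : (D : Node H → Bool) → (∀ {x y} → S x ≡ S y → D x ≡ D y) → D (endₕ X h) ≡ true →
      (∀ q → q ∈ₕ T′ → D (endₕ X q) ≡ true → S (src q) ≡ S (dst q)) → ⊥
    impossible D D-S Dh within = <-irrefl (sym (restrict-size X D {T} {T′} same)) (≤-trans
        (s≤s (acyclic-size≤ {F} {C} (acyclic-⊆ (λ q q∈ → proj₁ (restrict-∈ {X} {D} {T′} q q∈)) (tree-acyclic tree′)) spans))
        (≤-reflexive (sym one-more)))
      where
      F = restrict X D T′
      T₀ = removeHE H T h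
      C = restrict X D T₀
      one-more : size (restrict X D T) ≡ suc (size C)
      one-more = size-suc-at {restrict X D T} {C} h (∈-restrict {X} {D} {T} h h∈ Dh)
        (cong (_∧ D (endₕ X h)) (removeHE-self T h))
        (λ k k≢h k≢fh → cong (_∧ D (endₕ X k)) (sym (setHE-other false T k≢h k≢fh)))
      -- For an edge within one side of `S` both ends have the same value under `D`, so it does not
      -- matter which of them is the `X`-endpoint.
      end-D : ∀ q → S (src q) ≡ S (dst q) → D (endₕ X q) ≡ D (src q)
      end-D q eq with colour q ≟ₛ X
      ... | yes col = cong D (end-src q col)
      ... | no ¬col = trans (cong D (end-dst q ¬col)) (D-S (sym eq))
      inside : ∀ {x y} → Reach H T₀ x y → D x ≡ true → Reach H C x y
      inside here d = here
      inside (step a p) d with Adj⇒HE a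
      ... | g , g∈ , refl , refl = reach-trans
        (edge g (∈-restrict {X} {D} {T₀} g g∈ (trans (end-D g (closed g g∈)) d)))
        (inside p (trans (D-S (sym (closed g g∈))) d))
      joined : ∀ x y → S x ≡ S y → Reach H T₀ x y
      joined x y eq with S x in Sx
      ... | true = reach-trans (reach-sym (near Sx)) (near (sym eq))
      ... | false = reach-trans (reach-sym (far Sx)) (far (sym eq))
      spans : Spans C F
      spans q q∈ with restrict-∈ {X} {D} {T′} q q∈
      ... | q∈T′ , Dq = inside (joined _ _ eq) (trans (sym (end-D q eq)) Dq)
        where eq = within q q∈T′ Dq

  module JaegerTour (c : Side) (T : Sub H) (jaeger : JaegerTree H c T) where

    tree : IsTree H T
    tree = proj₂ (proj₁ jaeger)

    T⊆Bip : T ⊆ Bip H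
    T⊆Bip = ⊆ₛ-⊆ (proj₁ (proj₁ jaeger))

    open TreeTour T T⊆Bip tree public

    cut-first : ∀ {i j k} → colour k ≡ c → k ∉ₕ T → At i k → At j (flipHE H k) → i < j
    cut-first {i} {k = v , e , .c} refl k∉ At-i At-j =
      ComesFirst⇒first (proj₂ jaeger v e (subst Valid (proj₂ At-i) (pos-valid i)) k∉) At-i At-j

    -- The current graph when the process stands at time t of the tour.
    record State (t : ℕ) (G : Sub H) : Set where
      field
        ⊆Bip : G ⊆ Bip H
        T⊆ : T ⊆ G
        gone : ∀ {i k} → colour k ≡ c → k ∉ₕ T → At i k → i < t → k ∉ₕ G
        kept : ∀ {i k} → colour k ≡ c → At i k → t ≤ i → k ∈ₕ G

    module _ {t G h} (st : State t G) (At-t : At t h) (col : colour h ≡ c) (h∈ : h ∈ₕ T) where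
      open State st

      private
        G₀ = removeHE H G h

      not-flip : ∀ {b} → At b (flipHE H h) → t ≢ b
      not-flip (_ , eq) refl = flipSide≢ (colour h) (cong colour (trans (sym eq) (proj₂ At-t)))

      -- h is met again: no edge of the current graph other than h leaves the explored far side of h.
      bridge : ∀ {b} → At b (flipHE H h) → b < t → ¬ Reach H G₀ (src h) (dst h)
      bridge {b} At-b b<t p = true≢false src-side
        (trans (reach-closed {S} closed₀ (reach-sym p)) (trans (cong S (sym (dst-flip h))) dst-side))
        where
        sep = separation tree {flipHE H h} h∈
        open Separation sep
        open Excursion {flipHE H h} h∈ sep At-b (subst (At t) (sym (flip-involutive h)) At-t) b<t
        no-crossing : ∀ q → q ∈ₕ G₀ → S (src q) ≡ true → S (dst q) ≡ false → ⊥
        no-crossing q q∈ near-src far-dst with removeHE-∈ {G} {h} {q} q∈ | ∈∨∉ T q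
        ... | (q≢h , q≢fh) , q∈G | inj₁ q∈T = true≢false near-src (trans
                (closed q (∈-removeHE {T} {flipHE H h} {q} q≢fh (λ eq → q≢h (trans eq (flip-involutive h))) q∈T)) far-dst)
        ... | (q≢h , q≢fh) , q∈G | inj₂ q∉T with At-valid {q} (⊆Bip q q∈G) | At-valid {flipHE H q} (⊆Bip q q∈G)
        -- The far end of `q` is met by time `t`. Its `c`-coloured end is either that one or, by
        -- `cut-first`, was met still earlier, so `q` has been deleted.
        ... | i , At-i | j , At-j with far⇒inside At-j far-dst | colour q ≟ₛ c
        ... | b<j , j≤t | no ¬col = true≢false q∈G
                (gone {k = flipHE H q} (trans (cong flipSide (≢⇒flipSide ¬col)) (flipSide-involutive c)) q∉T At-j (≤∧≢⇒< j≤t λ where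
                  refl → true≢false h∈ (subst (_∉ₕ T) (trans (sym (proj₂ At-j)) (proj₂ At-t)) q∉T)))
        ... | b<j , j≤t | yes col = true≢false q∈G (gone {k = q} col q∉T At-i (<-≤-trans (cut-first col q∉T At-i At-j) j≤t))
        closed₀ : Closed S G₀
        closed₀ q q∈ with S (src q) in s | S (dst q) in d
        ... | true | true = refl
        ... | false | false = refl
        ... | true | false = ⊥-elim (no-crossing q q∈ s d)
        ... | false | true = ⊥-elim (no-crossing (flipHE H q) q∈ d (trans (cong S (dst-flip q)) s))

      -- h is met first: all edges of the current graph other than h that join the two sides of h have
      -- their c-coloured endpoint on the far side.
      tight : ∀ {b} → At b (flipHE H h) → t < b → ∀ X {T′} → IsTree H T′ → T′ ⊆ G₀ → SameDeg X T T′ → ⊥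
      tight {b} At-b t<b X {T′} tree′ T′⊆ same = conclude (X ≟ₛ c)
        where
        sep = separation tree {h} h∈
        open Separation sep
        open Excursion {h} h∈ sep At-t At-b t<b
        open DegreeCount tree h∈ sep tree′ X same
        oriented : ∀ q → q ∈ₕ G₀ → S (src q) ≡ true → S (dst q) ≡ false → colour q ≢ c
        oriented q q∈ near-src far-dst col with removeHE-∈ {G} {h} {q} q∈ | ∈∨∉ T q
        ... | (q≢h , q≢fh) , q∈G | inj₁ q∈T = true≢false near-src (trans (closed q (∈-removeHE {T} {h} {q} q≢h q≢fh q∈T)) far-dst)
        ... | (q≢h , q≢fh) , q∈G | inj₂ q∉T with At-valid {q} (⊆Bip q q∈G) | At-valid {flipHE H q} (⊆Bip q q∈G)
        -- If the near end of `q` had colour `c`, it would be met before the far end, hence not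
        -- after `b` but by time `t`; then `q` would be deleted already or equal to `h`.
        ... | i , At-i | j , At-j with far⇒inside At-j far-dst | near⇒outside At-i near-src | cut-first col q∉T At-i At-j
        ... | _ , j≤b | inj₂ b<i | i<j = <-irrefl refl (<-≤-trans (<-trans b<i i<j) j≤b)
        ... | _ , _ | inj₁ i≤t | _ = true≢false q∈G (gone {k = q} col q∉T At-i (≤∧≢⇒< i≤t λ where
                refl → q≢h (trans (sym (proj₂ At-i)) (proj₂ At-t))))
        same-side : (D : Node H → Bool) →
          (∀ q → colour q ≢ c → S (src q) ≡ true → S (dst q) ≡ false → D (endₕ X q) ≡ false) →
          ∀ q → q ∈ₕ T′ → D (endₕ X q) ≡ true → S (src q) ≡ S (dst q)
        same-side D out q q∈ Dq with S (src q) in s | S (dst q) in d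
        ... | true | true = refl
        ... | false | false = refl
        ... | true | false = contradiction (out q (oriented q (T′⊆ q q∈) s d) s d) (true≢false Dq)
        ... | false | true = contradiction
          (out (flipHE H q) (oriented (flipHE H q) (T′⊆ q q∈) d s′) d s′) (true≢false Dq)
          where s′ = trans (cong S (dst-flip q)) s
        -- `D` is the side containing the `X`-endpoint of `h`: the near side if `X` is the cut
        -- colour, the far side otherwise. Every other crossing edge of the current graph has its
        -- `X`-endpoint on the opposite side.
        conclude : Dec (X ≡ c) → ⊥
        conclude (yes refl) = impossible S (λ eq → eq) (trans (cong S (end-src h col)) src-side)
          (same-side S λ q ¬col _ d → trans (cong S (end-dst q ¬col)) d)
        conclude (no X≢c) = impossible (not ∘ S) (cong not)
          (cong not (trans (cong S (end-dst h (λ col′ → X≢c (trans (sym col′) col)))) dst-side))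
          (same-side (not ∘ S) λ q ¬col s _ →
            cong not (trans (cong S (end-src q (trans (≢⇒flipSide ¬col) (sym (≢⇒flipSide X≢c))))) s))

      unremovable : ∀ X {T′} → IsTree H T′ → T′ ⊆ G₀ → SameDeg X T T′ → ⊥
      unremovable X tree′ T′⊆ same with At-valid {flipHE H h} (T⊆Bip h h∈)
      ... | b , At-b with <-cmp t b
      ... | tri< t<b _ _ = tight At-b t<b X tree′ T′⊆ same
      ... | tri≈ _ t≡b _ = not-flip At-b t≡b
      ... | tri> _ _ b<t = bridge At-b b<t (reach-mono T′⊆ (proj₁ tree′ (src h) (dst h)))

    -- Each edge has exactly one half-edge of colour `c`, so these are enough to test.
    complete : ∀ {G} → T ⊆ G → (∀ {k} → colour k ≡ c → k ∉ₕ T → k ∉ₕ G) → G ⊆ T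
    complete {G} T⊆G none (v , e , s) k∈ with ∈∨∉ T (v , e , c)
    ... | inj₁ k∈T = k∈T
    ... | inj₂ k∉T = contradiction (none {v , e , c} refl k∉T) (true≢false k∈)

    ⊆-antisym : ∀ {G G′} → G ⊆ G′ → G′ ⊆ G → _≐_ H G G′
    ⊆-antisym {G} {G′} sub sup v e with G v e in eq | G′ v e in eq′
    ... | true | true = refl
    ... | false | false = refl
    ... | true | false = contradiction eq′ (true≢false (sub (v , e , atV) eq))
    ... | false | true = contradiction eq (true≢false (sup (v , e , atV) eq′))

    tree-edge : ∃ λ k → k ∈ₕ T
    tree-edge with proj₁ tree (inj₁ baseV) (inj₂ baseE)
    ... | step a _ with Adj⇒HE a
    ... | k , k∈ , _ = k , k∈

    -- The half-edges passed over are missing from `G`, hence from `T`, so the tour merely rotates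
    -- past them too. `k` is the current half-edge after a deletion and its flip after a traversal.
    skip : ∀ {G t k} → G ⊆ Bip H → T ⊆ G → k ∈ₕ G → pos (suc t) ≡ ρ k →
      ∃ λ m → succG H G k ≡ pos (m + suc t) × succG H G k ∈ₕ G ×
              (∀ j → j < m → pos (j + suc t) ∉ₕ G)
    skip {G} {t} {k} sub T⊆G k∈ eq with succG-iter sub k∈
    ... | m , succ≡ , ∈G , before = m , trans succ≡ (same m λ _ j<m → j<m) , ∈G , λ j j<m →
      subst (_∉ₕ G) (same j (λ i i<j → <-trans i<j j<m)) (before j j<m)
      where
      same : ∀ j → (∀ i → i < j → i < m) → iter H ρ j (ρ k) ≡ pos (j + suc t)
      same zero _ = sym eq
      same (suc j) lt = trans (cong ρ (same j (λ i i<j → lt i (<-trans i<j (n<1+n j)))))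
        (sym (τ-out {pos (j + suc t)} (subst (_∉ₕ T) (same j (λ i i<j → lt i (<-trans i<j (n<1+n j))))
          (Bool.¬-not λ ∈T → true≢false (T⊆G (iter H ρ j (ρ k)) ∈T) (before j (lt j (n<1+n j)))))))

    -- The first part shows that a half-edge is fresh while the process goes on, the second that it
    -- has been traversed when the process has to stop.
    Traversed : ℕ → List (HE H) → Set
    Traversed t trav = (∀ k → k ∈ trav → ∃ λ i → At i k × i < t)
                     × (∀ {i k} → k ∈ₕ T → At i k → i < t → k ∈ trav)

    -- The two hypotheses isolate what the simulation takes from hypertrees: any graph containing
    -- `T` admits the hypertree, and any graph admitting it contains a tree with the `X`-degrees of
    -- `T`.
    module Process (HT : Sub H → Set) (X : Side) (has-T : ∀ G → T ⊆ G → HT G)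
                   (realised : ∀ G → HT G → ∃ λ T′ → IsTree H T′ × T′ ⊆ G × SameDeg X T T′) where

      Finishes : Sub H → HE H → List (HE H) → Set
      Finishes G h trav = ∃ λ R → Run H HT G h trav R × _≐_ H R T

      not-removable : ∀ {t G h} → State t G → At t h → colour h ≡ c → h ∈ₕ T → ¬ HT (removeHE H G h)
      not-removable st At-t col h∈ ht with realised _ ht
      ... | T′ , tree′ , T′⊆ , same = unremovable st At-t col h∈ X tree′ T′⊆ same

      not-removable-at-end : ∀ {G h} → G ⊆ T → h ∈ₕ T → ¬ HT (removeHE H G h)
      not-removable-at-end {G} {h} G⊆T h∈ ht with realised _ ht
      ... | T′ , tree′ , T′⊆ , _ = tree-acyclic tree h h∈ (reach-mono
              (λ k k∈ → removeHE-mono {G} {T} {h} G⊆T k (T′⊆ k k∈)) (proj₁ tree′ (src h) (dst h)))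

      -- After a full period every non-edge of `T` has been met at its `c`-coloured end and deleted.
      -- What is left is `T`, and its half-edges have all been traversed.
      after-period : ∀ {t G h trav} → period ≤ t → State t G → h ∈ₕ G → Traversed t trav → Finishes G h trav
      after-period {t} {G} {h} {trav} p≤t st h∈ (_ , onto) =
        G , stop₁ (not-removable-at-end {G} {h} G⊆T h∈T) h∈trav , ⊆-antisym G⊆T T⊆
        where
        open State st
        G⊆T : G ⊆ T
        G⊆T = complete T⊆ λ {k} col k∉ → Bool.¬-not λ k∈ → let i , At-i = At-valid {k} (⊆Bip k k∈) in
          true≢false k∈ (gone {k = k} col k∉ At-i (<-≤-trans (proj₁ At-i) p≤t))
        h∈T = G⊆T h h∈
        h∈trav = let i , At-i = At-valid {h} (⊆Bip h h∈) in onto h∈T At-i (<-≤-trans (proj₁ At-i) p≤t)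

      -- Follows the process along the tour. The time `t` is not reduced modulo the period and grows
      -- at each step, so `fuel` only has to cover the rest of the first period.
      simulate : ∀ fuel {t G h trav} → period ≤ t + fuel → State t G → pos t ≡ h → h ∈ₕ G → colour h ≡ c →
        Traversed t trav → Finishes G h trav
      simulate fuel {t} bound st at h∈ col tr with t <? period
      ... | no t≮p = after-period (≮⇒≥ t≮p) st h∈ tr
      simulate zero {t} bound st at h∈ col tr | yes t<p = contradiction (subst (period ≤_) (+-identityʳ t) bound) (<⇒≱ t<p)
      simulate (suc fuel) {t} {G} {h} {trav} bound st at h∈ col tr@(into , onto) | yes t<p with ∈∨∉ T h
      ... | inj₂ h∉T = let R , run , R≐ = rest in R , remove removable run , R≐
        where
        open State st
        G₀ = removeHE H G h
        removable : HT G₀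
        removable = has-T G₀ λ k k∈ → ∈-removeHE {G} {h} {k}
          (λ { refl → true≢false k∈ h∉T }) (λ { refl → true≢false k∈ h∉T }) (T⊆ k k∈)
        skipped = skip {G} {t} {h} ⊆Bip T⊆ h∈ (trans (cong τ at) (τ-out {h} h∉T))
        m = proj₁ skipped
        h′ = succG H G h
        at′ : pos (m + suc t) ≡ h′
        at′ = sym (proj₁ (proj₂ skipped))
        h′∈G : h′ ∈ₕ G
        h′∈G = proj₁ (proj₂ (proj₂ skipped))
        absent : ∀ j → j < m → pos (j + suc t) ∉ₕ G
        absent j j<m = proj₂ (proj₂ (proj₂ skipped)) j j<m
        t<t′ : t < m + suc t
        t<t′ = m≤n+m (suc t) m
        col′ : colour h′ ≡ c
        col′ = trans (colour-succG G h) col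
        no-tree-edge : ∀ {n} → t < n → n < m + suc t → pos n ∉ₕ T
        no-tree-edge t<n n<t′ with between n<t′
        ... | inj₁ n<t = contradiction t<n (<-asym n<t)
        ... | inj₂ (inj₁ refl) = contradiction refl (<⇒≢ t<n)
        ... | inj₂ (inj₂ (j , j<m , refl)) = Bool.¬-not λ ∈T → true≢false (T⊆ (pos (j + suc t)) ∈T) (absent j j<m)
        -- If h were the only edge of G at its node, the skip would last a whole period and miss T.
        h′≢h : h′ ≢ h
        h′≢h eq with repeats-late t<t′ (trans at (sym (trans at′ eq))) | At-valid {proj₁ tree-edge} (T⊆Bip (proj₁ tree-edge) (proj₂ tree-edge))
        ... | late | i , i<p , atᵢ with <-cmp t i
        ... | tri< t<i _ _ = true≢false (proj₂ tree-edge) (subst (_∉ₕ T) atᵢ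
                (no-tree-edge t<i (<-≤-trans i<p (≤-trans (m≤n+m period t) late))))
        ... | tri≈ _ refl _ = true≢false (proj₂ tree-edge) (subst (_∉ₕ T) (trans (sym at) atᵢ) h∉T)
        ... | tri> _ _ i<t = true≢false (proj₂ tree-edge) (subst (_∉ₕ T) (trans (pos-period i) atᵢ)
                (no-tree-edge (<-≤-trans t<p (m≤n+m period i)) (<-≤-trans (+-monoˡ-< period i<t) late)))
        h′∈G₀ : h′ ∈ₕ G₀
        h′∈G₀ = ∈-removeHE {G} {h} {h′} h′≢h
          (λ eq → flipSide≢ (colour h) (trans (sym (cong colour eq)) (trans col′ (sym col)))) h′∈G
        state′ : State (m + suc t) G₀
        state′ = record
          { ⊆Bip = λ k k∈ → ⊆Bip k (removeHE-⊆ {G} {h} k k∈)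
          ; T⊆ = λ k k∈ → ∈-removeHE {G} {h} {k}
              (λ { refl → true≢false k∈ h∉T }) (λ { refl → true≢false k∈ h∉T }) (T⊆ k k∈)
          ; gone = gone′
          ; kept = λ {i} {k} colₖ At-i t′≤i → ∈-removeHE {G} {h} {k}
              (λ { refl → <⇒≢ (<-≤-trans t<t′ t′≤i) (At-unique (t<p , at) At-i) })
              (λ { refl → flipSide≢ (colour h) (trans colₖ (sym col)) })
              (kept colₖ At-i (≤-trans (<⇒≤ t<t′) t′≤i))
          }
          where
          gone′ : ∀ {i k} → colour k ≡ c → k ∉ₕ T → At i k → i < m + suc t → k ∉ₕ G₀
          gone′ {i} {k} colₖ k∉T At-i i<t′ with between i<t′
          ... | inj₁ i<t = Bool.¬-not λ k∈ → true≢false (removeHE-⊆ {G} {h} k k∈) (gone {k = k} colₖ k∉T At-i i<t)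
          ... | inj₂ (inj₁ refl) with trans (sym at) (proj₂ At-i)
          ...   | refl = removeHE-self G h
          gone′ {i} {k} colₖ k∉T (_ , refl) i<t′ | inj₂ (inj₂ (j , j<m , refl)) =
            Bool.¬-not λ k∈ → true≢false (removeHE-⊆ {G} {h} k k∈) (absent j j<m)
        traversed′ : Traversed (m + suc t) trav
        traversed′ = (λ k k∈ → let i , At-i , i<t = into k k∈ in i , At-i , <-trans i<t t<t′) , onto′
          where
          onto′ : ∀ {i k} → k ∈ₕ T → At i k → i < m + suc t → k ∈ trav
          onto′ {i} {k} k∈T At-i i<t′ with between i<t′
          ... | inj₁ i<t = onto k∈T At-i i<t
          ... | inj₂ (inj₁ refl) with trans (sym at) (proj₂ At-i)
          ...   | refl = contradiction h∉T (true≢false k∈T)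
          onto′ {i} {k} k∈T (_ , refl) i<t′ | inj₂ (inj₂ (j , j<m , refl)) =
            contradiction (absent j j<m) (true≢false (T⊆ k k∈T))
        rest : Finishes G₀ h′ trav
        rest = simulate fuel
          (≤-trans bound (≤-trans (≤-reflexive (+-suc t fuel)) (+-monoˡ-≤ fuel (m≤n+m (suc t) m))))
          state′ at′ h′∈G₀ col′ traversed′
      ... | inj₁ h∈T = finish
        where
        open State st
        g = succG H G (flipHE H h)
        skipped = skip {G} {t} {flipHE H h} ⊆Bip T⊆ h∈ (trans (cong τ at) (τ-in {h} h∈T))
        m = proj₁ skipped
        t₂ = m + suc t
        at-g : pos t₂ ≡ g
        at-g = sym (proj₁ (proj₂ skipped))
        g∈G : g ∈ₕ G
        g∈G = proj₁ (proj₂ (proj₂ skipped))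
        absent : ∀ j → j < m → pos (j + suc t) ∉ₕ G
        absent j j<m = proj₂ (proj₂ (proj₂ skipped)) j j<m
        t<t₂ : t < t₂
        t<t₂ = m≤n+m (suc t) m
        col-g : colour g ≡ flipSide c
        col-g = trans (colour-succG G (flipHE H h)) (cong flipSide col)
        h-stays : ¬ HT (removeHE H G h)
        h-stays = not-removable st (t<p , at) col h∈T
        fresh : h ∉ trav
        fresh h∈trav = let i , At-i , i<t = into h h∈trav in <⇒≢ i<t (At-unique At-i (t<p , at))
        gone-before-g : ∀ {i k} → colour k ≡ c → k ∉ₕ T → At i k → i < t₂ → k ∉ₕ G
        gone-before-g {i} {k} colₖ k∉T At-i i<t₂ with between i<t₂
        ... | inj₁ i<t = gone {k = k} colₖ k∉T At-i i<t
        ... | inj₂ (inj₁ refl) with trans (sym at) (proj₂ At-i)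
        ...   | refl = contradiction k∉T (true≢false h∈T)
        gone-before-g {i} {k} colₖ k∉T (_ , refl) i<t₂ | inj₂ (inj₂ (j , j<m , refl)) = absent j j<m
        onto-before-g : ∀ {i k} → k ∈ₕ T → At i k → i < t₂ → k ∈ h ∷ trav
        onto-before-g {i} {k} k∈T At-i i<t₂ with between i<t₂
        ... | inj₁ i<t = there (onto k∈T At-i i<t)
        ... | inj₂ (inj₁ refl) = here (trans (sym (proj₂ At-i)) at)
        onto-before-g {i} {k} k∈T (_ , refl) i<t₂ | inj₂ (inj₂ (j , j<m , refl)) =
          contradiction (absent j j<m) (true≢false (T⊆ k k∈T))
        finish : Finishes G h trav
        finish with t₂ <? period
        -- The tour closes up between `h` and `g`. By then the current graph is `T`, so `g` is a
        -- tree edge traversed before.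
        ... | no t₂≮p = G , stop₂ h-stays fresh g-seen , ⊆-antisym G⊆T T⊆
          where
          G⊆T : G ⊆ T
          G⊆T = complete T⊆ λ {k} colₖ k∉ → Bool.¬-not λ k∈ → let i , At-i = At-valid {k} (⊆Bip k k∈) in
            true≢false k∈ (gone-before-g {k = k} colₖ k∉ At-i (<-≤-trans (proj₁ At-i) (≮⇒≥ t₂≮p)))
          g-seen : g ∈ h ∷ trav
          g-seen = let i , At-i = At-valid {g} (⊆Bip g g∈G) in
            onto-before-g {k = g} (G⊆T g g∈G) At-i (<-≤-trans (proj₁ At-i) (≮⇒≥ t₂≮p))
        ... | yes t₂<p = let R , run , R≐ = rest in R , next h-stays fresh g-fresh run , R≐
          where
          At-g : At t₂ g
          At-g = t₂<p , at-g
          g-fresh : g ∉ h ∷ trav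
          g-fresh (here g≡h) = flipSide≢ c (trans (sym col-g) (trans (cong colour g≡h) col))
          g-fresh (there g∈) = let i , At-i , i<t = into g g∈ in <⇒≢ (<-trans i<t t<t₂) (At-unique At-i At-g)
          g∈T : g ∈ₕ T
          g∈T with ∈∨∉ T g
          ... | inj₁ g∈T = g∈T
          -- A non-edge of `T` is met first at its `c`-coloured end; `g`, met here at the other end,
          -- would have been deleted before.
          ... | inj₂ g∉T = let i , At-i = At-valid {flipHE H g} (⊆Bip g g∈G) in
            contradiction (gone-before-g {k = flipHE H g} col-fg g∉T At-i
              (cut-first {k = flipHE H g} col-fg g∉T At-i (subst (At t₂) (sym (flip-involutive g)) At-g))) (true≢false g∈G)
            where col-fg = trans (cong flipSide col-g) (flipSide-involutive c)
          h″ = succG H G (flipHE H g)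
          skipped₂ = skip {G} {t₂} {flipHE H g} ⊆Bip T⊆ g∈G (trans (cong τ at-g) (τ-in {g} g∈T))
          l = proj₁ skipped₂
          t₃ = l + suc t₂
          absent₂ : ∀ j → j < l → pos (j + suc t₂) ∉ₕ G
          absent₂ j j<l = proj₂ (proj₂ (proj₂ skipped₂)) j j<l
          t₂<t₃ : t₂ < t₃
          t₂<t₃ = m≤n+m (suc t₂) l
          state″ : State t₃ G
          state″ = record
            { ⊆Bip = ⊆Bip
            ; T⊆ = T⊆
            ; gone = gone″
            ; kept = λ colₖ At-i t₃≤i → kept colₖ At-i (≤-trans (<⇒≤ (<-trans t<t₂ t₂<t₃)) t₃≤i)
            }
            where
            gone″ : ∀ {i k} → colour k ≡ c → k ∉ₕ T → At i k → i < t₃ → k ∉ₕ G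
            gone″ {i} {k} colₖ k∉T At-i i<t₃ with between i<t₃
            ... | inj₁ i<t₂ = gone-before-g {k = k} colₖ k∉T At-i i<t₂
            ... | inj₂ (inj₁ refl) with trans (sym at-g) (proj₂ At-i)
            ...   | refl = contradiction k∉T (true≢false g∈T)
            gone″ {i} {k} colₖ k∉T (_ , refl) i<t₃ | inj₂ (inj₂ (j , j<l , refl)) = absent₂ j j<l
          traversed″ : Traversed t₃ (g ∷ h ∷ trav)
          traversed″ = into″ , onto″
            where
            into″ : ∀ k → k ∈ g ∷ h ∷ trav → ∃ λ i → At i k × i < t₃
            into″ k (here refl) = t₂ , At-g , t₂<t₃
            into″ k (there (here refl)) = t , (t<p , at) , <-trans t<t₂ t₂<t₃
            into″ k (there (there k∈)) = let i , At-i , i<t = into k k∈ in i , At-i , <-trans i<t (<-trans t<t₂ t₂<t₃)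
            onto″ : ∀ {i k} → k ∈ₕ T → At i k → i < t₃ → k ∈ g ∷ h ∷ trav
            onto″ {i} {k} k∈T At-i i<t₃ with between i<t₃
            ... | inj₁ i<t₂ = there (onto-before-g {k = k} k∈T At-i i<t₂)
            ... | inj₂ (inj₁ refl) = here (trans (sym (proj₂ At-i)) at-g)
            onto″ {i} {k} k∈T (_ , refl) i<t₃ | inj₂ (inj₂ (j , j<l , refl)) =
              contradiction (absent₂ j j<l) (true≢false (T⊆ k k∈T))
          rest : Finishes G h″ (g ∷ h ∷ trav)
          rest = simulate fuel
            (≤-trans bound (≤-trans (≤-reflexive (+-suc t fuel)) (+-monoˡ-≤ fuel (≤-trans t<t₂ (<⇒≤ t₂<t₃)))))
            state″ (sym (proj₁ (proj₂ skipped₂))) (proj₁ (proj₂ (proj₂ skipped₂)))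
            (trans (colour-succG G (flipHE H g)) (trans (cong flipSide col-g) (flipSide-involutive c)))
            traversed″

  -- Unfolds to `HypertreeV` or `HypertreeE` according to `X`, so that one argument serves all four
  -- processes.
  HypertreeOn : (X : Side) → (Fin (class X) → ℕ) → Sub H → Set
  HypertreeOn X f G = Σ (Sub H) λ T → SpanningTreeOf H G T × (∀ x → deg X T x ≡ suc (f x))

  start-cases : ∀ c →
    (startHE H c ≡ baseHE H × startTrav H c ≡ [] × colour (baseHE H) ≡ c) ⊎
    (startHE H c ≡ ρ (flipHE H (baseHE H)) × startTrav H c ≡ baseHE H ∷ [] × colour (baseHE H) ≡ flipSide c)
  start-cases atV with baseS in eq
  ... | atV = inj₁ (cong (λ s → baseV , baseE , s) eq , refl , refl)
  ... | atE = inj₂ (cong (λ s → ρ (flipHE H (baseV , baseE , s))) eq , cong (λ s → (baseV , baseE , s) ∷ []) eq , refl)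
  start-cases atE with baseS in eq
  ... | atE = inj₁ (cong (λ s → baseV , baseE , s) eq , refl , refl)
  ... | atV = inj₂ (cong (λ s → ρ (flipHE H (baseV , baseE , s))) eq , cong (λ s → (baseV , baseE , s) ∷ []) eq , refl)

  Outcome : Side → (X : Side) → (Fin (class X) → ℕ) → Sub H → Set
  Outcome c X f R = Run H (HypertreeOn X f) (Bip H) (startHE H c) (startTrav H c) R

  jaeger-outcome : ∀ {c T} → JaegerTree H c T → ∀ X {f} → (∀ x → deg X T x ≡ suc (f x)) →
    ∃ λ R → Outcome c X f R × _≐_ H R T
  jaeger-outcome {c} {T} jaeger X {f} degrees = begin-process (start-cases c)
    where
    open JaegerTour c T jaeger
    open Process (HypertreeOn X f) X
      (λ G T⊆G → T , (⊆-⊆ₛ T⊆G , tree) , degrees)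
      (λ G (T′ , (T′⊆ , tree′) , degrees′) → T′ , tree′ , ⊆ₛ-⊆ T′⊆ , λ x → trans (degrees x) (sym (degrees′ x)))
    b = baseHE H
    begin-process : _ ⊎ _ → ∃ λ R → Outcome c X f R × _≐_ H R T
    begin-process (inj₁ (h≡ , trav≡ , col)) = subst₂ (Finishes (Bip H)) (sym h≡) (sym trav≡)
      (simulate period {0} ≤-refl
        (record { ⊆Bip = λ _ k∈ → k∈ ; T⊆ = T⊆Bip ; gone = λ _ _ _ ()
                ; kept = λ {i} _ (_ , eq) _ → subst Valid eq (pos-valid i) })
        refl base-inc col ((λ _ ()) , λ _ _ ()))
    -- The base edge turns out to lie in `T`, so the starting half-edge is the tour position at time
    -- 1 and the base half-edge counts as traversed at time 0.
    begin-process (inj₂ (h≡ , trav≡ , col)) = subst₂ (Finishes (Bip H)) (sym h≡) (sym trav≡)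
      (simulate period {1} (m≤n+m period 1) state₁ (τ-in {b} b∈T) (ρ-valid {flipHE H b} base-inc)
        (trans (colour-succG (Bip H) (flipHE H b)) col-fb) traversed₁)
      where
      col-fb : colour (flipHE H b) ≡ c
      col-fb = trans (cong flipSide col) (flipSide-involutive c)
      at-b : At 0 b
      at-b = z<s , refl
      b∈T : b ∈ₕ T
      b∈T with ∈∨∉ T b
      ... | inj₁ b∈ = b∈
      ... | inj₂ b∉ with At-valid {flipHE H b} base-inc
      -- As a non-edge, the base edge would be met at its `c`-coloured end before time 0.
      ... | i , At-i with () ← cut-first {k = flipHE H b} col-fb b∉ At-i (subst (At 0) (sym (flip-involutive b)) at-b)
      state₁ : State 1 (Bip H)
      state₁ = record
        { ⊆Bip = λ _ k∈ → k∈
        ; T⊆ = T⊆Bip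
        ; gone = λ { {zero} colₖ _ (_ , refl) _ → contradiction (trans (sym col) colₖ) (flipSide≢ c)
                   ; {suc _} _ _ _ (s≤s ()) }
        ; kept = λ {i} _ (_ , eq) _ → subst Valid eq (pos-valid i)
        }
      traversed₁ : Traversed 1 (b ∷ [])
      traversed₁ = (λ { k (here refl) → 0 , at-b , z<s }) ,
        λ { {zero} _ (_ , refl) _ → here refl ; {suc _} _ _ (s≤s ()) }

  -- Existence of Jaeger trees with given degrees

  -- `g` is the edge by which the walk leaves `z` for the last time: what follows avoids `z` and
  -- with it every edge at `z`. The third alternative, a walk that avoids `z` throughout, carries
  -- the induction.
  first-edge : ∀ {T z x y} → Reach H T x y →
    (∃ λ g → g ∈ₕ T × src g ≡ z × Reach H (removeHE H T g) (dst g) y) ⊎ y ≡ z ⊎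
    (x ≢ z × (∀ g → src g ≡ z → Reach H (removeHE H T g) x y))
  first-edge {z = z} {x} here with x ≟ₙ z
  ... | yes x≡z = inj₂ (inj₁ x≡z)
  ... | no x≢z = inj₂ (inj₂ (x≢z , λ _ _ → here))
  first-edge {T} {z} {x} (step a p) with first-edge {z = z} p | Adj⇒HE a
  ... | inj₁ found | _ = inj₁ found
  ... | inj₂ (inj₁ y≡z) | _ = inj₂ (inj₁ y≡z)
  ... | inj₂ (inj₂ (≢z , avoid)) | h , h∈ , refl , refl with x ≟ₙ z
  ... | yes x≡z = inj₁ (h , h∈ , x≡z , avoid h x≡z)
  ... | no x≢z = inj₂ (inj₂ (x≢z , λ g g≡z → reach-trans (edge h (∈-removeHE {T} {g} {h}
          (λ { refl → x≢z g≡z }) (λ { refl → ≢z (trans (dst-flip g) g≡z) }) h∈)) (avoid g g≡z)))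

  src≢dst : ∀ h → src h ≢ dst h
  src≢dst (_ , _ , atV) ()
  src≢dst (_ , _ , atE) ()

  -- `M` is the common part; each of the two graphs adds to it one edge at the same node of the
  -- colour in question.
  swap-deg : ∀ {G G′ M} h k → src h ≡ src k →
    h ∈ₕ G → h ∉ₕ M → (∀ j → j ≢ h → j ≢ flipHE H h → value G j ≡ value M j) →
    k ∈ₕ G′ → k ∉ₕ M → (∀ j → j ≢ k → j ≢ flipHE H k → value G′ j ≡ value M j) →
    SameDeg (colour h) G G′
  swap-deg (v , e , atV) (.v , e′ , atV) refl h∈ h∉ same k∈ k∉ same′ x with x ≟ v
  ... | yes refl = trans
    (countF-suc-at nE e h∈ h∉ λ i i≢ → same (v , i , atV) (i≢ ∘ cong (proj₁ ∘ proj₂)) (i≢ ∘ cong (proj₁ ∘ proj₂)))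
    (sym (countF-suc-at nE e′ k∈ k∉ λ i i≢ → same′ (v , i , atV) (i≢ ∘ cong (proj₁ ∘ proj₂)) (i≢ ∘ cong (proj₁ ∘ proj₂))))
  ... | no x≢v = countF-cong nE λ i → trans (same (x , i , atV) (x≢v ∘ cong proj₁) (x≢v ∘ cong proj₁))
    (sym (same′ (x , i , atV) (x≢v ∘ cong proj₁) (x≢v ∘ cong proj₁)))
  swap-deg (v , e , atE) (v′ , .e , atE) refl h∈ h∉ same k∈ k∉ same′ x with x ≟ e
  ... | yes refl = trans
    (countF-suc-at nV v h∈ h∉ λ i i≢ → same (i , e , atE) (i≢ ∘ cong proj₁) (i≢ ∘ cong proj₁))
    (sym (countF-suc-at nV v′ k∈ k∉ λ i i≢ → same′ (i , e , atE) (i≢ ∘ cong proj₁) (i≢ ∘ cong proj₁)))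
  ... | no x≢e = countF-cong nV λ i → trans (same (i , x , atE) (x≢e ∘ cong (proj₁ ∘ proj₂)) (x≢e ∘ cong (proj₁ ∘ proj₂)))
    (sym (same′ (i , x , atE) (x≢e ∘ cong (proj₁ ∘ proj₂)) (x≢e ∘ cong (proj₁ ∘ proj₂))))

  src-colour : ∀ {h k} → src h ≡ src k → colour h ≡ colour k
  src-colour {_ , _ , atV} {_ , _ , atV} _ = refl
  src-colour {_ , _ , atE} {_ , _ , atE} _ = refl

  -- When `r` is a non-edge of `T`, `g` is the first edge at `src r` of its fundamental cycle, and
  -- `around` is the rest of that cycle up to `dst r`.
  record Exchange (T : Sub H) (r : HE H) : Set where
    field
      g : HE H
      g∈T : g ∈ₕ T
      src-g : src g ≡ src r
      around : Reach H (removeHE H T g) (dst g) (dst r)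

    T′ : Sub H
    T′ = addHE (removeHE H T g) r

  exchange : ∀ {T} → IsTree H T → ∀ r → Exchange T r
  exchange tree r with first-edge {z = src r} (proj₁ tree (src r) (dst r))
  ... | inj₁ (g , g∈ , src-g , around) = record { g = g ; g∈T = g∈ ; src-g = src-g ; around = around }
  ... | inj₂ (inj₁ eq) = contradiction (sym eq) (src≢dst r)
  ... | inj₂ (inj₂ (≢ , _)) = contradiction refl ≢

  module Exchanged {T r} (tree : IsTree H T) (r∉ : r ∉ₕ T) (ex : Exchange T r) where
    open Exchange ex
    private
      T₀ = removeHE H T g
      r∉T₀ : r ∉ₕ T₀
      r∉T₀ = Bool.¬-not λ r∈ → true≢false (removeHE-⊆ {T} {g} r r∈) r∉

    -- The number of edges is unchanged, so connectedness suffices; the side cut off by deleting `g`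
    -- is reached through `r`.
    tree′ : IsTree H T′
    tree′ = connected-tree {T} {T′} tree (trans (size-removeHE {T} g g∈T) (sym (size-addHE {T₀} r r∉T₀)))
      λ x y → reach-trans (reach-sym (from x)) (from y)
      where
      sep = separation tree {g} g∈T
      open Separation sep
      up : ∀ {x y} → Reach H T₀ x y → Reach H T′ x y
      up = reach-mono (⊆-addHE {T₀} {r})
      from : ∀ x → Reach H T′ (src r) x
      from x with S x in Sx
      ... | true = up (subst (λ z → Reach H T₀ z x) src-g (near Sx))
      ... | false = reach-trans (edge r (setHE-self true T₀ r))
        (up (reach-trans (reach-sym around) (far Sx)))

    same-deg : SameDeg (colour r) T T′
    same-deg = subst (λ X → SameDeg X T T′) (src-colour {g} {r} src-g) (swap-deg {T} {T′} {T₀} g r src-g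
      g∈T (removeHE-self T g) (λ j j≢ j≢f → sym (setHE-other false T j≢ j≢f))
      (setHE-self true T₀ r) r∉T₀ (λ j → setHE-other true T₀ {r} {j}))

    ⊆Bip′ : Valid r → T ⊆ Bip H → T′ ⊆ Bip H
    ⊆Bip′ rv T⊆ k k∈ with addHE-∈ {T₀} {r} {k} k∈
    ... | inj₁ (inj₁ refl) = rv
    ... | inj₁ (inj₂ refl) = rv
    ... | inj₂ k∈T₀ = T⊆ k (removeHE-⊆ {T} {g} k k∈T₀)

    value′-g : g ∉ₕ T′
    value′-g = trans (setHE-other true T₀ {r} {g}
      (λ eq → true≢false (subst (_∈ₕ T) eq g∈T) r∉) (λ eq → true≢false (subst (_∈ₕ T) eq g∈T) r∉)) (removeHE-self T g)

    value′-r : r ∈ₕ T′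
    value′-r = setHE-self true T₀ r

    value′-other : ∀ {k} → k ≢ g → k ≢ flipHE H g → k ≢ r → k ≢ flipHE H r → value T′ k ≡ value T k
    value′-other k≢g k≢fg k≢r k≢fr = trans (setHE-other true T₀ k≢r k≢fr) (setHE-other false T k≢g k≢fg)

  tour-agrees : ∀ {T T′} n → (∀ t → t < n → value T′ (tour H T t) ≡ value T (tour H T t)) →
    ∀ t → t ≤ n → tour H T′ t ≡ tour H T t
  tour-agrees n same zero _ = refl
  tour-agrees {T} {T′} n same (suc t) t<n = trans (cong (tourStep H T′) (tour-agrees {T} {T′} n same t (<⇒≤ t<n)))
    (cong (λ b → if b then ρ (flipHE H (tour H T t)) else ρ (tour H T t)) (same t t<n))

  on-edge : ∀ {q r} (P : HE H → Set) → r ≡ q ⊎ r ≡ flipHE H q → P q → P (flipHE H q) → P r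
  on-edge P (inj₁ refl) p _ = p
  on-edge P (inj₂ refl) _ p = p

  module Descent (c : Side) where

    -- A position of the tour is penalised when a c-coloured half-edge is in T or another one is not.
    -- Along the exchange below the word of penalties drops lexicographically.
    penalty : Sub H → HE H → Bool
    penalty T h = if does (colour h ≟ₛ c) then value T h else not (value T h)

    weight : Sub H → ℕ
    weight T = binary (λ t → penalty T (tour H T t)) HE-count

    penalty-value : ∀ {T T′} h → value T′ h ≡ value T h → penalty T′ h ≡ penalty T h
    penalty-value h eq = cong (λ b → if does (colour h ≟ₛ c) then b else not b) eq

    penalty-c : ∀ {T} h → colour h ≡ c → penalty T h ≡ value T h
    penalty-c {T} h col = cong (if_then value T h else not (value T h)) (dec-true (colour h ≟ₛ c) col)

    penalty-¬c : ∀ {T} h → colour h ≢ c → penalty T h ≡ not (value T h)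
    penalty-¬c {T} h col = cong (if_then value T h else not (value T h)) (dec-false (colour h ≟ₛ c) col)

    weight-drops : ∀ {T T′} k → k < HE-count →
      (∀ t → t < k → value T′ (tour H T t) ≡ value T (tour H T t)) →
      penalty T (tour H T k) ≡ true → penalty T′ (tour H T k) ≡ false → weight T′ < weight T
    weight-drops {T} {T′} k k<K same bad good = binary-lex {λ t → penalty T′ (tour H T′ t)} {λ t → penalty T (tour H T t)} HE-count k<K
      (λ t t<k → trans (cong (penalty T′) (agrees t (<⇒≤ t<k))) (penalty-value {T} {T′} (tour H T t) (same t t<k)))
      (trans (cong (penalty T′) (agrees k ≤-refl)) good) bad
      where
      agrees = tour-agrees {T} {T′} k same

    module _ {T} (T⊆ : T ⊆ Bip H) (tree : IsTree H T) where
      open TreeTour T T⊆ tree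

      record Violation : Set where
        field
          q : HE H
          wrong-colour : colour q ≢ c
          q∉T : q ∉ₕ T
          {i j} : ℕ
          At-i : At i q
          At-j : At j (flipHE H q)
          i<j : i < j

      jaeger-or-violation : JaegerTree H c T ⊎ Violation
      jaeger-or-violation with all-or-some-edge {λ v e → inc v e ≡ true → T v e ≡ false → ComesFirst H T (v , e , c)} {λ _ _ → Violation} check
        where
        check : ∀ v e → (inc v e ≡ true → T v e ≡ false → ComesFirst H T (v , e , c)) ⊎ Violation
        check v e with ∈∨∉ (Bip H) (v , e , c) | ∈∨∉ T (v , e , c)
        ... | inj₂ ∉Bip | _ = inj₁ λ ∈Bip → contradiction ∉Bip (true≢false ∈Bip)
        ... | _ | inj₁ ∈T = inj₁ λ _ ∉T → contradiction ∉T (true≢false ∈T)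
        ... | inj₁ hv | inj₂ h∉ with At-valid {v , e , c} hv | At-valid {v , e , flipSide c} hv
        ... | i , At-i | j , At-j with <-cmp i j
        ... | tri< i<j _ _ = inj₁ λ _ _ → first⇒ComesFirst At-i At-j i<j
        ... | tri≈ _ refl _ = contradiction (cong colour (trans (sym (proj₂ At-j)) (proj₂ At-i))) (flipSide≢ c)
        ... | tri> _ _ j<i = inj₂ record
          { q = v , e , flipSide c ; wrong-colour = flipSide≢ c ; q∉T = h∉
          ; At-i = At-j ; At-j = subst (At i) (sym (flip-involutive (v , e , c))) At-i ; i<j = j<i }
      ... | inj₁ first = inj₁ ((⊆-⊆ₛ T⊆ , tree) , first)
      ... | inj₂ (_ , _ , violation) = inj₂ violation

      -- `r` is the violating edge oriented so that its source lies in the class whose degrees are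
      -- to be kept.
      module Repair (violation : Violation) (r : HE H) (r-edge : r ≡ Violation.q violation ⊎ r ≡ flipHE H (Violation.q violation)) where
        open Violation violation

        r∉T : r ∉ₕ T
        r∉T = on-edge (_∉ₕ T) r-edge q∉T q∉T

        ex : Exchange T r
        ex = exchange tree r

        open Exchange ex
        open Exchanged tree r∉T ex

        not-q⇒not-r : ∀ {k} → k ≢ q → k ≢ flipHE H q → k ≢ r × k ≢ flipHE H r
        not-q⇒not-r {k} k≢q k≢fq = on-edge (λ r → k ≢ r × k ≢ flipHE H r) r-edge
          (k≢q , k≢fq) (k≢fq , λ eq → k≢q (trans eq (flip-involutive q)))

        q∈T′ : q ∈ₕ T′
        q∈T′ = on-edge (λ r → r ∈ₕ T′ → q ∈ₕ T′) r-edge (λ ∈T′ → ∈T′) (λ ∈T′ → ∈T′) value′-r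

        untouched-until : ∀ k {a b} → At a g → At b (flipHE H g) → k ≤ a → k ≤ b → k ≤ i →
          ∀ t → t < k → value T′ (pos t) ≡ value T (pos t)
        untouched-until k At-a At-b k≤a k≤b k≤i t t<k =
          value′-other (missed At-a k≤a) (missed At-b k≤b) (proj₁ not-r) (proj₂ not-r)
          where
          missed : ∀ {n h} → At n h → k ≤ n → pos t ≢ h
          missed At-n@(n<p , _) k≤n eq = <⇒≢ (<-≤-trans t<k k≤n) (At-unique (<-trans (<-≤-trans t<k k≤n) n<p , eq) At-n)
          not-r = not-q⇒not-r (missed At-i k≤i) (missed At-j (≤-trans k≤i (<⇒≤ i<j)))

        -- `q` crosses the fundamental cut of `γ` in the same direction as `γ` itself.
        Near-Far : HE H → Set
        Near-Far γ = ∀ {S} → Closed S (removeHE H T γ) → S (src γ) ≡ true → S (dst γ) ≡ false →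
          S (src q) ≡ true × S (dst q) ≡ false

        -- If the tour enters the far side through γ before meeting q, it exhausts that side, flip q included, first.
        not-entered : ∀ {γ a b} → γ ∈ₕ T → At a γ → At b (flipHE H γ) → a < b → a < i → ¬ Near-Far γ
        not-entered {γ} γ∈ At-a At-b a<b a<i near-far with separation tree {γ} γ∈
        ... | sep with near-far {Separation.S sep} (Separation.closed sep) (Separation.src-side sep) (Separation.dst-side sep)
        ... | q-near , q-far with Excursion.near⇒outside {γ} γ∈ sep At-a At-b a<b At-i q-near
                                | Excursion.far⇒inside {γ} γ∈ sep At-a At-b a<b At-j q-far
        ... | inj₁ i≤a | _ = <⇒≱ a<i i≤a
        ... | inj₂ b<i | _ , j≤b = <⇒≱ (<-trans b<i i<j) j≤b

        drop-at-q : ∀ {a b} → At a g → At b (flipHE H g) → i < a → i < b → weight T′ < weight T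
        drop-at-q At-a At-b i<a i<b = weight-drops {T} {T′} i (<-≤-trans (proj₁ At-i) period≤)
          (untouched-until i At-a At-b (<⇒≤ i<a) (<⇒≤ i<b) ≤-refl)
          (trans (cong (penalty T) (proj₂ At-i)) (trans (penalty-¬c {T} q wrong-colour) (cong not q∉T)))
          (trans (cong (penalty T′) (proj₂ At-i)) (trans (penalty-¬c {T′} q wrong-colour) (cong not q∈T′)))

        drop-at-g : ∀ {a b γ} → At a g → At b (flipHE H g) → ∀ {k} → k ≤ a → k ≤ b → k < i →
          pos k ≡ γ → γ ∈ₕ T → γ ∉ₕ T′ → colour γ ≡ c → weight T′ < weight T
        drop-at-g {γ = γ} At-a@(a<p , _) At-b {k} k≤a k≤b k<i refl γ∈ γ∉ col =
          weight-drops {T} {T′} k (<-≤-trans (≤-<-trans k≤a a<p) period≤)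
            (untouched-until k At-a At-b k≤a k≤b (<⇒≤ k<i))
            (trans (penalty-c {T} γ col) γ∈) (trans (penalty-c {T′} γ col) γ∉)

        colour-r : colour r ≢ c → r ≡ q
        colour-r = on-edge (λ r → colour r ≢ c → r ≡ q) r-edge (λ _ → refl)
          λ ≢c → contradiction (trans (cong flipSide (≢⇒flipSide wrong-colour)) (flipSide-involutive c)) ≢c

        colour-r′ : colour r ≡ c → r ≡ flipHE H q
        colour-r′ = on-edge (λ r → colour r ≡ c → r ≡ flipHE H q) r-edge (λ ≡c → contradiction ≡c wrong-colour) (λ _ → refl)

        -- The first difference of the penalty words is at `q` or at the first visit of `g`,
        -- whichever comes earlier. `q` is a penalised non-edge that enters the tree, `g` met at its
        -- `c`-coloured end a penalised tree edge that leaves it. That `g` is met earlier at its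
        -- other end is excluded by `not-entered`.
        weight-drop : weight T′ < weight T
        weight-drop with At-valid {g} (T⊆ g g∈T) | At-valid {flipHE H g} (T⊆ g g∈T)
        ... | a , At-a | b , At-b with <-cmp a b
        ... | tri≈ _ refl _ = contradiction (cong colour (trans (sym (proj₂ At-b)) (proj₂ At-a))) (flipSide≢ (colour g))
        ... | tri< a<b _ _ with <-cmp i a
        ...   | tri< i<a _ _ = drop-at-q At-a At-b i<a (<-trans i<a a<b)
        ...   | tri≈ _ refl _ = contradiction (subst (_∉ₕ T) (trans (sym (proj₂ At-i)) (proj₂ At-a)) q∉T) (true≢false g∈T)
        ...   | tri> _ _ a<i with colour g ≟ₛ c
        ...     | yes col = drop-at-g At-a At-b ≤-refl (<⇒≤ a<b) a<i (proj₂ At-a) g∈T value′-g col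
        -- The colour of `g` forces `r` to be `q`. Then `q` and `g` leave the same node, and
        -- `around` joins their other ends without using `g`.
        ...     | no ≢c = ⊥-elim (not-entered {g} g∈T At-a At-b a<b a<i λ {S} cl s d →
                    trans (cong S (trans (cong src (sym r≡q)) (sym src-g))) s ,
                    trans (cong (S ∘ dst) (sym r≡q)) (trans (sym (reach-closed {S} cl around)) d))
          where r≡q = colour-r (λ col → ≢c (trans (src-colour {g} {r} src-g) col))
        weight-drop | a , At-a | b , At-b | tri> _ _ b<a with <-cmp i b
        ...   | tri< i<b _ _ = drop-at-q At-a At-b (<-trans i<b b<a) i<b
        ...   | tri≈ _ refl _ = contradiction (subst (_∉ₕ T) (trans (sym (proj₂ At-i)) (proj₂ At-b)) q∉T) (true≢false g∈T)
        ...   | tri> _ _ b<i with colour (flipHE H g) ≟ₛ c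
        ...     | yes col = drop-at-g At-a At-b (<⇒≤ b<a) ≤-refl b<i (proj₂ At-b) g∈T value′-g col
        -- Mirror image: `r` is the flip of `q`, so `q` and the flip of `g` end at the same node,
        -- and `around` joins their sources.
        ...     | no ≢c = ⊥-elim (not-entered {flipHE H g} g∈T At-b (subst (At a) (sym (flip-involutive g)) At-a) b<a b<i λ {S} cl s d →
                    trans (cong S (trans (sym (dst-flip q)) (cong dst (sym r≡fq)))) (trans (sym (reach-closed {S} cl around)) s) ,
                    trans (cong S (trans (cong src (sym r≡fq)) (trans (sym src-g) (sym (dst-flip g))))) d)
          where
          r≡fq = colour-r′ (trans (sym (src-colour {g} {r} src-g))
            (trans (sym (flipSide-involutive (colour g))) (trans (cong flipSide (≢⇒flipSide ≢c)) (flipSide-involutive c))))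

        repaired : ∀ {X} → colour r ≡ X → ∃ λ T′ → T′ ⊆ Bip H × IsTree H T′ × SameDeg X T T′ × weight T′ < weight T
        repaired refl = T′ , ⊆Bip′ r-valid T⊆ , tree′ , same-deg , weight-drop
          where
          q-valid : Valid q
          q-valid = subst Valid (proj₂ At-i) (pos-valid i)
          r-valid : Valid r
          r-valid = on-edge Valid r-edge q-valid q-valid

      improve : Violation → ∀ X → ∃ λ T′ → T′ ⊆ Bip H × IsTree H T′ × SameDeg X T T′ × weight T′ < weight T
      improve violation X with colour (Violation.q violation) ≟ₛ X
      ... | yes col = Repair.repaired violation (Violation.q violation) (inj₁ refl) col
      ... | no ≢X = Repair.repaired violation (flipHE H (Violation.q violation)) (inj₂ refl)
              (trans (cong flipSide (≢⇒flipSide ≢X)) (flipSide-involutive X))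

    -- Repairs keep the degrees on `X` and lower the weight, so they come to an end, which happens
    -- only at a Jaeger tree. `n` bounds the number of repairs.
    jaeger-with-degrees : ∀ X n T → weight T < n → T ⊆ Bip H → IsTree H T → ∃ λ T′ → JaegerTree H c T′ × SameDeg X T T′
    jaeger-with-degrees X (suc n) T w<n T⊆ tree with jaeger-or-violation T⊆ tree
    ... | inj₁ jaeger = T , jaeger , λ _ → refl
    ... | inj₂ violation with improve T⊆ tree violation X
    ... | T₁ , T₁⊆ , tree₁ , same₁ , drop with jaeger-with-degrees X n T₁ (<-≤-trans drop (s≤s⁻¹ w<n)) T₁⊆ tree₁
    ... | T₂ , jaeger , same₂ = T₂ , jaeger , λ x → trans (same₁ x) (same₂ x)

  -- Determinism of the process and the equivalence.

  run-deterministic : ∀ {HT G h trav R R′} → Run H HT G h trav R → Run H HT G h trav R′ → R ≡ R′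
  run-deterministic (remove _ r) (remove _ r′) = run-deterministic r r′
  run-deterministic (remove y _) (stop₁ n _) = contradiction y n
  run-deterministic (remove y _) (stop₂ n _ _) = contradiction y n
  run-deterministic (remove y _) (next n _ _ _) = contradiction y n
  run-deterministic (stop₁ n _) (remove y _) = contradiction y n
  run-deterministic (stop₁ _ _) (stop₁ _ _) = refl
  -- Both stopping rules return the current graph.
  run-deterministic (stop₁ _ _) (stop₂ _ _ _) = refl
  run-deterministic (stop₁ _ h∈) (next _ h∉ _ _) = contradiction h∈ h∉
  run-deterministic (stop₂ n _ _) (remove y _) = contradiction y n
  run-deterministic (stop₂ _ _ _) (stop₁ _ _) = refl
  run-deterministic (stop₂ _ _ _) (stop₂ _ _ _) = refl
  run-deterministic (stop₂ _ _ ∈tr) (next _ _ ∉tr _) = contradiction ∈tr ∉tr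
  run-deterministic (next n _ _ _) (remove y _) = contradiction y n
  run-deterministic (next _ h∉ _ _) (stop₁ _ h∈) = contradiction h∈ h∉
  run-deterministic (next _ _ ∉tr _) (stop₂ _ _ ∈tr) = contradiction ∈tr ∉tr
  run-deterministic (next _ _ _ r) (next _ _ _ r′) = run-deterministic r r′

  -- Outcomes are compared with trees pointwise, so the property is transported along this relation;
  -- pointwise equal graphs have the same tour.
  jaeger-≐ : ∀ {c T T′} → _≐_ H T T′ → JaegerTree H c T → JaegerTree H c T′
  jaeger-≐ {c} {T} {T′} eq ((T⊆ , conn , min) , first) =
    ((λ v e ∈T′ → T⊆ v e (trans (eq v e) ∈T′)) ,
     (λ x y → reach-mono to (conn x y)) ,
     λ v e ∈T′ conn′ → min v e (trans (eq v e) ∈T′)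
       λ x y → reach-mono (removeHE-mono {T′} {T} {v , e , atV} from) (conn′ x y)) ,
    λ v e hv ∉T′ → transport (first v e hv (trans (eq v e) ∉T′))
    where
    to : T ⊆ T′
    to (v , e , _) = trans (sym (eq v e))
    from : T′ ⊆ T
    from (v , e , _) = trans (eq v e)
    same-tour : ∀ n → tour H T′ n ≡ tour H T n
    same-tour n = tour-agrees {T} {T′} n (λ t _ → sym (eq _ _)) n ≤-refl
    transport : ∀ {h} → ComesFirst H T h → ComesFirst H T′ h
    transport (i , at , no-return , not-flip) = i , trans (same-tour i) at ,
      (λ k 0<k k≤i eq → no-return k 0<k k≤i (trans (sym (same-tour k)) eq)) ,
      λ k k≤i eq → not-flip k k≤i (trans (sym (same-tour k)) eq)

  -- A walk to the end of the base edge in the other colour class is not empty, and its first edge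
  -- is at `x`. Hence degree minus one is a natural number and defines a hypertree.
  deg-positive : ∀ {T} → Connected H T → ∀ X x → ∃ λ m → deg X T x ≡ suc m
  deg-positive conn atV v with conn (inj₁ v) (inj₂ baseE)
  ... | step (ve {e = e} ∈T) _ = countF-positive nE e ∈T
  deg-positive conn atE e with conn (inj₂ e) (inj₁ baseV)
  ... | step (ev {v = v} ∈T) _ = countF-positive nV v ∈T

  outcomes-are-jaeger : ∀ c X T →
    (Σ (Fin (class X) → ℕ) λ f → HypertreeOn X f (Bip H) × Σ (Sub H) λ R → Outcome c X f R × _≐_ H R T) ⇔ JaegerTree H c T
  outcomes-are-jaeger c X T = mk⇔ to from
    where
    to : _ → JaegerTree H c T
    to (f , (T₀ , (T₀⊆ , tree₀) , degrees₀) , R , run , R≐T)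
      with Descent.jaeger-with-degrees c X _ T₀ ≤-refl (⊆ₛ-⊆ T₀⊆) tree₀
    ... | T₁ , jaeger , same with jaeger-outcome jaeger X {f} (λ x → trans (sym (same x)) (degrees₀ x))
    -- The Jaeger tree realising `f` has a run of its own for `f`; determinism identifies its result
    -- with the given outcome.
    ... | R₁ , run₁ , R₁≐T₁ with run-deterministic run run₁
    ... | refl = jaeger-≐ (λ v e → trans (sym (R₁≐T₁ v e)) (R≐T v e)) jaeger
    from : JaegerTree H c T → _
    from jaeger@((T⊆ , tree) , _) = f , (T , (T⊆ , tree) , degrees) , jaeger-outcome jaeger X degrees
      where
      f : Fin (class X) → ℕ
      f x = proj₁ (deg-positive (proj₁ tree) X x)
      degrees : ∀ x → deg X T x ≡ suc (f x)
      degrees x = proj₂ (deg-positive (proj₁ tree) X x)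

theorem6p17 : (H : RibbonHG) → Connected H (Bip H) →
    (∀ T → InOutcomesE H atV T ⇔ JaegerTree H atV T)
    × (∀ T → InOutcomesV H atV T ⇔ JaegerTree H atV T)
    × (∀ T → InOutcomesE H atE T ⇔ JaegerTree H atE T)
    × (∀ T → InOutcomesV H atE T ⇔ JaegerTree H atE T)
theorem6p17 H _ = outcomes-are-jaeger atV atE , outcomes-are-jaeger atV atV ,
                  outcomes-are-jaeger atE atE , outcomes-are-jaeger atE atV
  where open RibbonTheory H
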